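{- Fix integers $r\ge 4$ and $k\ge 2$, a real $B>0$, and a real $$\varepsilon<\frac{2}{3r-5}.$$ There is $M=M(r,k,B,\varepsilon)$ such that the following holds. If a graph $G$ contains a subgraph $J$ with $$\chi(J)=m\ge M,\qquad e(J)\le B m^{2+\varepsilon},$$ then $G$ contains a subgraph $H$ with $\operatorname{girth}(H)\ge r$ and $\chi(H)\ge k$.
   Context: All graphs are finite and simple; subgraphs need not be induced. $\chi$ is the chromatic number, $e(J)$ the number of edges of $J$. The girth of a forest is $\infty$. -}

module Defs where

open import Level using (0ℓ)
open import Data.Nat.Base as ℕ using (ℕ; suc; NonZero)
import Data.Nat.Properties as ℕ
open import Data.Integer.Base using (+_; -[1+_])
open import Data.Rational.Base using (ℚ; _+_; _-_; -_; _*_; _≤_; _<_; _/_; ↥_; ↧ₙ_; +-*-rawSemiring)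
import Data.Rational.Properties as ℚ
open import Data.Fin.Base as Fin using (Fin; zero; suc; fromℕ; inject₁)
import Data.Fin.Properties as Fin
open import Data.Fin.Subset using (Subset; _∈_; _⊆_)
open import Data.List.Base using (length; filter; allFin; cartesianProduct)
open import Data.Product.Base using (_×_; _,_; ∃; proj₁; proj₂)
open import Data.Sum.Base using (_⊎_)
open import Function.Base using (_∘_)
open import Function.Definitions using (Injective)
open import Relation.Binary.Core using (Rel)
open import Relation.Binary.Definitions using (Decidable; Symmetric; Irreflexive)
open import Relation.Binary.PropositionalEquality
open import Relation.Nullary using (¬_)
open import Relation.Nullary.Decidable using (_×-dec_)
open import Relation.Nullary.Construct.Add.Supremum public using (_⁺; [_]; ⊤⁺)
open import Relation.Binary.Construct.Add.Supremum.NonStrict ℕ._≤_ public using (_≤⁺_)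
open import Algebra.Definitions.RawSemiring +-*-rawSemiring using (_^_)

------------------------------------------------------------------------
-- Dedekind real numbers: L p means p < x, and U q means x < q.

record ℝ : Set₁ where
  field
    L U         : ℚ → Set
    L-inhabited : ∃ L
    U-inhabited : ∃ U
    L-lower     : ∀ {p q} → p < q → L q → L p
    L-open      : ∀ {p} → L p → ∃ λ q → p < q × L q
    U-upper     : ∀ {p q} → p < q → U p → U q
    U-open      : ∀ {q} → U q → ∃ λ p → p < q × U p
    disjoint    : ∀ q → ¬ (L q × U q)
    located     : ∀ {p q} → p < q → L p ⊎ U q

infix 4 _<ᴸ_ _<ᵁ_

_<ᴸ_ : ℚ → ℝ → Set
q <ᴸ x = ℝ.L x q

_<ᵁ_ : ℝ → ℚ → Set
x <ᵁ q = ℝ.U x q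

private
  p+c-c : ∀ p c → (p + c) - c ≡ p
  p+c-c p c = trans (ℚ.+-assoc p c (- c))
    (trans (cong (λ z → p + z) (ℚ.+-inverseʳ c)) (ℚ.+-identityʳ p))

  p-c+c : ∀ p c → (p - c) + c ≡ p
  p-c+c p c = trans (ℚ.+-assoc p (- c) c)
    (trans (cong (λ z → p + z) (ℚ.+-inverseˡ c)) (ℚ.+-identityʳ p))

infixr 6 _+ʳ_

_+ʳ_ : ℚ → ℝ → ℝ
c +ʳ x = record
  { L           = λ p → L (p - c)
  ; U           = λ q → U (q - c)
  ; L-inhabited = shift L L-inhabited
  ; U-inhabited = shift U U-inhabited
  ; L-lower     = L-lower ∘ ℚ.+-monoˡ-< (- c)
  ; L-open      = λ {p} Lp → let q , p-c<q , Lq = L-open Lp in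
      q + c , subst (_< q + c) (p-c+c p c) (ℚ.+-monoˡ-< c p-c<q)
            , subst L (sym (p+c-c q c)) Lq
  ; U-upper     = U-upper ∘ ℚ.+-monoˡ-< (- c)
  ; U-open      = λ {q} Uq → let p , p<q-c , Up = U-open Uq in
      p + c , subst (p + c <_) (p-c+c q c) (ℚ.+-monoˡ-< c p<q-c)
            , subst U (sym (p+c-c p c)) Up
  ; disjoint    = λ q → disjoint (q - c)
  ; located     = located ∘ ℚ.+-monoˡ-< (- c)
  }
  where
  open ℝ x
  shift : (P : ℚ → Set) → ∃ P → ∃ λ p → P (p - c)
  shift P (p , Pp) = p + c , subst P (sym (p+c-c p c)) Pp

ℕ⇒ℚ : ℕ → ℚ
ℕ⇒ℚ n = + n / 1

-- n ≤ b · m ^ s for rational b > 0 and s = a / d, with m ≥ 1: both sides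
-- are raised to the power d, and a negative power of m is moved to the left.
infix 4 _≤ᵠ_·_^_ _≤ʳ_·_^_

_≤ᵠ_·_^_ : ℕ → ℚ → ℕ → ℚ → Set
n ≤ᵠ b · m ^ s with ↥ s
... | + a      = ℕ⇒ℚ n ^ (↧ₙ s) ≤ b ^ (↧ₙ s) * ℕ⇒ℚ m ^ a
... | -[1+ a ] = ℕ⇒ℚ n ^ (↧ₙ s) * ℕ⇒ℚ m ^ suc a ≤ b ^ (↧ₙ s)

-- n ≤ B · m ^ x for real B > 0 and x, with m ≥ 1: the real number B · m ^ x
-- is the infimum of b · m ^ s over the rationals b > B and s > x.
_≤ʳ_·_^_ : ℕ → ℝ → ℕ → ℝ → Set
n ≤ʳ B · m ^ x = ∀ b s → B <ᵁ b → x <ᵁ s → n ≤ᵠ b · m ^ s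

3r∸5-nonZero : ∀ {r} → 4 ℕ.≤ r → NonZero (3 ℕ.* r ℕ.∸ 5)
3r∸5-nonZero 4≤r =
  ℕ.>-nonZero (ℕ.m<n⇒0<n∸m (ℕ.≤-trans (ℕ.m≤m+n 6 6) (ℕ.*-monoʳ-≤ 3 4≤r)))

------------------------------------------------------------------------
-- Finite simple graphs.  The vertex set is a subset V of Fin n, so that a
-- graph and its subgraphs share one type.

record Graph (n : ℕ) : Set₁ where
  field
    V       : Subset n
    _~_     : Rel (Fin n) 0ℓ
    _~?_    : Decidable _~_
    ~-sym   : Symmetric _~_
    ~-irr   : Irreflexive _≡_ _~_
    ~-left  : ∀ {u v} → u ~ v → u ∈ V

  ~-right : ∀ {u v} → u ~ v → v ∈ V
  ~-right = ~-left ∘ ~-sym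

infix 4 _⊑_

_⊑_ : ∀ {n} → Graph n → Graph n → Set
H ⊑ G = (V H ⊆ V G) × (∀ {u v} → _~_ H u v → _~_ G u v)
  where open Graph

-- Each edge is counted once, as a pair u < v.
e : ∀ {n} → Graph n → ℕ
e {n} G = length (filter (λ p → (proj₁ p Fin.<? proj₂ p) ×-dec (proj₁ p ~? proj₂ p))
                         (cartesianProduct (allFin n) (allFin n)))
  where open Graph G

Colouring : ∀ {n} → Graph n → ℕ → Set
Colouring {n} G k =
  ∃ λ (c : (v : Fin n) → v ∈ V → Fin k) →
    ∀ {u v} (uv : u ~ v) → c u (~-left uv) ≢ c v (~-right uv)
  where open Graph G

-- The relation χ(G) = m.
χ[_]≡_ : ∀ {n} → Graph n → ℕ → Set
χ[ G ]≡ m = Colouring G m × (∀ j → Colouring G j → m ℕ.≤ j)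

data Cycle {n} (G : Graph n) : ℕ → Set where
  cycle : ∀ {l} (c : Fin (3 ℕ.+ l) → Fin n) → Injective _≡_ _≡_ c →
          (∀ i → Graph._~_ G (c (inject₁ i)) (c (suc i))) →
          Graph._~_ G (c (fromℕ (2 ℕ.+ l))) (c zero) →
          Cycle G (3 ℕ.+ l)

-- The relation girth(G) = g, with values in ℕ ∪ {∞}; ⊤⁺ is ∞.
girth[_]≡_ : ∀ {n} → Graph n → ℕ ⁺ → Set
girth[ G ]≡ [ g ] = Cycle G g × (∀ l → Cycle G l → g ℕ.≤ l)
girth[ G ]≡ ⊤⁺    = ∀ l → ¬ Cycle G l

{-# OPTIONS --safe #-}
module Submission where

-- Sample the edges of J and destroy the surviving short cycles. Deleting vertices of
-- degree < m - 1 leaves a J[W] that is still not (m-1)-colourable, and minimum degree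
-- gives |W| ≤ 4y with y ≈ e(J)/m. Keep each edge with probability 1/q, where q ≈ s²/(24y)
-- and s ≈ m/k. With positive probability,
--   * every S ⊆ W spanning at least s²/2 edges of J keeps more than y of them, by a Chernoff
--     bound and a union bound over the at most 2^(4y) sets S;
--   * at most y cycles of length ℓ < r survive: J has at most (2e(J))^(ℓ/2) of them, and
--     (2e(J))^(ℓ/2) / q^ℓ is small compared with y exactly when ε < 2/(3ℓ-2).
-- Now delete an edge of every surviving short cycle. In a colouring of the remaining graph
-- every colour class spans fewer than s²/2 edges of J, hence is s-colourable in J, so k - 1
-- classes would give an (m-1)-colouring of J[W].

open import Defs
open import Data.Nat.Base using (ℕ; _≤_; _*_; _∸_)
open import Data.Integer.Base using (+_)
open import Data.Rational.Base using (_/_; 0ℚ)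
open import Data.Product.Base using (_×_; ∃; ∃-syntax)

open import Data.Bool.Base using (true; false; if_then_else_)
open import Data.Fin.Base as Fin using (Fin; zero; suc; toℕ; inject₁; fromℕ)
import Data.Fin.Properties as Fin
open import Data.Fin.Subset using (Subset; inside; outside; ∣_∣; _-_) renaming (_∈_ to _∈ˢ_; _⊆_ to _⊆ˢ_)
import Data.Fin.Subset.Properties as Sub
open import Data.Integer.Base as ℤ using (-[1+_])
import Data.Integer.Properties as ℤ
open import Data.List.Base
  using (List; []; _∷_; _++_; length; map; filter; concatMap; cartesianProduct; cartesianProductWith;
         lookup; upTo; allFin; tabulate)
import Data.List.Properties as List
import Data.List.Membership.DecPropositional as DecMembership
open import Data.List.Membership.Propositional using (_∈_; _∉_; find; lose)
open import Data.List.Membership.Propositional.Properties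
  using (∈-lookup; ∈-upTo⁻; ∈-upTo⁺; ∈-allFin; ∈-filter⁺; ∈-filter⁻; ∈-map⁺; ∈-cartesianProduct⁺;
         ∈-cartesianProductWith⁺; ∈-concatMap⁺; ∈-++⁺ˡ; ∈-++⁺ʳ)
open import Data.List.Relation.Ternary.Interleaving.Propositional using (Interleaving; []; consˡ; consʳ)
open import Data.List.Relation.Unary.All as All using (All; []; _∷_)
open import Data.List.Relation.Unary.All.Properties using (¬Any⇒All¬)
open import Data.List.Relation.Unary.AllPairs using ([]; _∷_)
open import Data.List.Relation.Unary.Any as Any using (here; there)
open import Data.List.Relation.Unary.Any.Properties using (lookup-index)
open import Data.List.Relation.Unary.Unique.Propositional using (Unique)
open import Data.List.Relation.Unary.Unique.Propositional.Properties
  using (upTo⁺; tabulate⁺; filter⁺; cartesianProduct⁺; allFin⁺)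
open import Data.Nat.Base as ℕ using (zero; suc; pred; _+_; _^_; _<_; z≤n; s≤s; NonZero; >-nonZero)
import Data.Nat.DivMod as ℕ
open import Data.Nat.Induction using (<-wellFounded)
import Data.Nat.Properties as ℕ
open import Data.Nat.Tactic.RingSolver using (solve-∀)
open import Data.Product.Base using (_,_; proj₁; proj₂)
open import Data.Product.Properties using (≡-dec)
open import Data.Rational.Base as ℚ using (ℚ; mkℚ; toℚᵘ; ↥_; ↧ₙ_)
import Data.Rational.Properties as ℚ
open import Data.Rational.Unnormalised.Base as ℚᵘ using (ℚᵘ; mkℚᵘ; *<*; _≃_)
import Data.Rational.Unnormalised.Properties as ℚᵘ
open import Data.Sum.Base as Sum using (_⊎_; inj₁; inj₂)
open import Data.Vec.Base as Vec using (Vec)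
import Data.Vec.Properties as Vec
open import Data.Vec.Properties.WithK using ([]=-irrelevant)
open import Function.Base using (_∘_; id)
open import Induction.WellFounded using (Acc; acc)
open import Relation.Binary.Construct.Add.Supremum.NonStrict ℕ._≤_ using ([_]; _≤⊤⁺)
open import Relation.Binary.Definitions using (tri<; tri≈; tri>)
open import Relation.Binary.PropositionalEquality hiding ([_])
open import Relation.Nullary using (¬_; Dec; yes; no; does; contradiction)
open import Relation.Nullary.Decidable
  using (dec-true; dec-false; map′; _×-dec_; _→-dec_; ¬?; decidable-stable)
open import Level using (0ℓ)
open import Relation.Unary using (Pred; Decidable)
open import Algebra.Definitions.RawSemiring ℚ.+-*-rawSemiring using () renaming (_^_ to _^ℚ_)

-- The exponent comes from the worst case e(J) = m^(2+ε). There y is of order m^(1+ε) and 1/q of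
-- order m^(ε-1), so (2e(J))^(ℓ/2) / q^ℓ has order m^(3εℓ/2), which is below y when 3εℓ/2 < 1 + ε,
-- that is ε < 2/(3ℓ-2). The longest cycle to destroy has ℓ = r - 1, whence 2/(3r-5). Neither the
-- number of vertices of J nor its maximum degree is bounded suitably in terms of m. The first would
-- ruin the union bound over vertex sets, hence the passage to W; the second is why cycles are
-- counted through e(J) alone. Both random events are measured against the same y: a set that keeps
-- more than y edges still spans an edge after one edge of each of at most y cycles is gone.
-- Everything stays in the natural numbers: a mean is multiplied by the total weight q^e(J), and an
-- inequality with half-integral exponents is squared.

private variable
  A C X : Set

-- Sums over lists

𝟙 : {P : Set} → Dec P → ℕ
𝟙 P? = if does P? then 1 else 0

𝟙-true : {P : Set} (P? : Dec P) → P → 𝟙 P? ≡ 1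
𝟙-true P? p rewrite dec-true P? p = refl

𝟙-false : {P : Set} (P? : Dec P) → ¬ P → 𝟙 P? ≡ 0
𝟙-false P? ¬p rewrite dec-false P? ¬p = refl

𝟙-mono : {P Q : Set} (P? : Dec P) (Q? : Dec Q) → (P → Q) → 𝟙 P? ≤ 𝟙 Q?
𝟙-mono (yes p) Q? f = ℕ.≤-reflexive (sym (𝟙-true Q? (f p)))
𝟙-mono (no _)  Q? f = z≤n

𝟙-cong : {P Q : Set} (P? : Dec P) (Q? : Dec Q) → (P → Q) → (Q → P) → 𝟙 P? ≡ 𝟙 Q?
𝟙-cong P? Q? f g = ℕ.≤-antisym (𝟙-mono P? Q? f) (𝟙-mono Q? P? g)

𝟙≤1 : {P : Set} (P? : Dec P) → 𝟙 P? ≤ 1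
𝟙≤1 (yes _) = ℕ.≤-refl
𝟙≤1 (no _)  = z≤n

𝟙-× : {P Q : Set} (P? : Dec P) (Q? : Dec Q) → 𝟙 P? * 𝟙 Q? ≡ 𝟙 (P? ×-dec Q?)
𝟙-× (yes _) (yes _) = refl
𝟙-× (yes _) (no _)  = refl
𝟙-× (no _)  _       = refl

∑ : List A → (A → ℕ) → ℕ
∑ []       f = 0
∑ (x ∷ xs) f = f x + ∑ xs f

infix 5 ∑
syntax ∑ xs (λ x → t) = ∑[ x ∈ xs ] t

count : {P : Pred A 0ℓ} → Decidable P → List A → ℕ
count P? xs = ∑[ x ∈ xs ] 𝟙 (P? x)

∑-mono : ∀ (xs : List A) {f g} → (∀ x → x ∈ xs → f x ≤ g x) → ∑ xs f ≤ ∑ xs g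
∑-mono []       h = z≤n
∑-mono (x ∷ xs) h = ℕ.+-mono-≤ (h x (here refl)) (∑-mono xs (λ y → h y ∘ there))

∑-cong : ∀ (xs : List A) {f g} → (∀ x → f x ≡ g x) → ∑ xs f ≡ ∑ xs g
∑-cong []       h = refl
∑-cong (x ∷ xs) h = cong₂ _+_ (h x) (∑-cong xs h)

∑-zero : ∀ (xs : List A) → ∑[ x ∈ xs ] 0 ≡ 0
∑-zero []       = refl
∑-zero (_ ∷ xs) = ∑-zero xs

∑-const : ∀ (xs : List A) c → ∑[ x ∈ xs ] c ≡ length xs * c
∑-const []       c = refl
∑-const (_ ∷ xs) c = cong (c ℕ.+_) (∑-const xs c)

∑-+ : ∀ (xs : List A) f g → ∑[ x ∈ xs ] (f x + g x) ≡ ∑ xs f + ∑ xs g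
∑-+ []       f g = refl
∑-+ (x ∷ xs) f g rewrite ∑-+ xs f g = lemma (f x) (g x) (∑ xs f) (∑ xs g)
  where
  lemma : ∀ a b c d → a + b + (c + d) ≡ a + c + (b + d)
  lemma = solve-∀

∑-*ˡ : ∀ (xs : List A) c f → ∑[ x ∈ xs ] (c * f x) ≡ c * ∑ xs f
∑-*ˡ []       c f = sym (ℕ.*-zeroʳ c)
∑-*ˡ (x ∷ xs) c f rewrite ∑-*ˡ xs c f = sym (ℕ.*-distribˡ-+ c (f x) (∑ xs f))

∑-swap : ∀ (xs : List A) (ys : List C) (f : A → C → ℕ) →
         (∑[ x ∈ xs ] ∑[ y ∈ ys ] f x y) ≡ (∑[ y ∈ ys ] ∑[ x ∈ xs ] f x y)
∑-swap []       ys f = sym (∑-zero ys)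
∑-swap (x ∷ xs) ys f = trans (cong (∑ ys (f x) ℕ.+_) (∑-swap xs ys f))
  (sym (∑-+ ys (f x) (λ y → ∑[ x ∈ xs ] f x y)))

∑-++ : ∀ (xs ys : List A) f → ∑ (xs ++ ys) f ≡ ∑ xs f + ∑ ys f
∑-++ []       ys f = refl
∑-++ (x ∷ xs) ys f = trans (cong (f x ℕ.+_) (∑-++ xs ys f)) (sym (ℕ.+-assoc (f x) _ _))

∑-map : ∀ (g : C → A) xs f → ∑ (map g xs) f ≡ ∑ xs (f ∘ g)
∑-map g []       f = refl
∑-map g (x ∷ xs) f = cong (f (g x) ℕ.+_) (∑-map g xs f)

∑-cartesianProduct : ∀ (xs : List A) (ys : List C) f →
  ∑ (cartesianProduct xs ys) f ≡ (∑[ x ∈ xs ] ∑[ y ∈ ys ] f (x , y))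
∑-cartesianProduct []       ys f = refl
∑-cartesianProduct (x ∷ xs) ys f =
  trans (∑-++ (map (x ,_) ys) (cartesianProduct xs ys) f)
        (cong₂ _+_ (∑-map (x ,_) ys f) (∑-cartesianProduct xs ys f))

∑-filter : ∀ {P : Pred A 0ℓ} (P? : Decidable P) xs f →
           ∑ (filter P? xs) f ≡ (∑[ x ∈ xs ] 𝟙 (P? x) * f x)
∑-filter P? []       f = refl
∑-filter P? (x ∷ xs) f with P? x
... | yes _ = cong₂ _+_ (sym (ℕ.+-identityʳ (f x))) (∑-filter P? xs f)
... | no _  = ∑-filter P? xs f

length-filter : ∀ {P : Pred A 0ℓ} (P? : Decidable P) xs → length (filter P? xs) ≡ count P? xs
length-filter P? []       = refl
length-filter P? (x ∷ xs) with P? x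
... | yes _ = cong suc (length-filter P? xs)
... | no _  = length-filter P? xs

term≤∑ : ∀ (xs : List A) f {x} → x ∈ xs → f x ≤ ∑ xs f
term≤∑ (x ∷ xs) f (here refl)  = ℕ.m≤m+n (f x) _
term≤∑ (y ∷ xs) f (there x∈xs) = ℕ.≤-trans (term≤∑ xs f x∈xs) (ℕ.m≤n+m _ (f y))

count-none : ∀ {P : Pred A 0ℓ} (P? : Decidable P) xs → (∀ x → x ∈ xs → ¬ P x) → count P? xs ≡ 0
count-none P? []       h = refl
count-none P? (x ∷ xs) h =
  cong₂ _+_ (𝟙-false (P? x) (h x (here refl))) (count-none P? xs (λ y → h y ∘ there))

-- Random subsets of a list

-- Each element of a list is kept with probability 1/(1+w), independently, and
-- expect w xs Φ is (1+w)^|xs| times the mean of Φ at (kept elements, dropped elements).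
expect : ℕ → List A → (List A → List A → ℕ) → ℕ
expect w []       Φ = Φ [] []
expect w (x ∷ xs) Φ = expect w xs (λ R D → Φ (x ∷ R) D) + w * expect w xs (λ R D → Φ R (x ∷ D))

module _ (w : ℕ) where
  expect-cong : ∀ (xs : List A) {Φ Ψ} → (∀ R D → Φ R D ≡ Ψ R D) → expect w xs Φ ≡ expect w xs Ψ
  expect-cong []       h = h [] []
  expect-cong (x ∷ xs) h = cong₂ _+_ (expect-cong xs (λ R → h (x ∷ R)))
                                     (cong (w *_) (expect-cong xs (λ R D → h R (x ∷ D))))

  expect-0 : ∀ (xs : List A) → expect w xs (λ _ _ → 0) ≡ 0
  expect-0 []       = refl
  expect-0 (_ ∷ xs) rewrite expect-0 xs = ℕ.*-zeroʳ w

  expect-+ : ∀ (xs : List A) Φ Ψ →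
             expect w xs (λ R D → Φ R D + Ψ R D) ≡ expect w xs Φ + expect w xs Ψ
  expect-+ []       Φ Ψ = refl
  expect-+ (x ∷ xs) Φ Ψ
    rewrite expect-+ xs (λ R → Φ (x ∷ R)) (λ R → Ψ (x ∷ R))
          | expect-+ xs (λ R D → Φ R (x ∷ D)) (λ R D → Ψ R (x ∷ D))
    = lemma w (expect w xs (λ R → Φ (x ∷ R))) _ _ _
    where
    lemma : ∀ w a b c d → a + b + w * (c + d) ≡ a + w * c + (b + w * d)
    lemma = solve-∀

  expect-*ˡ : ∀ (xs : List A) c Φ → expect w xs (λ R D → c * Φ R D) ≡ c * expect w xs Φ
  expect-*ˡ []       c Φ = refl
  expect-*ˡ (x ∷ xs) c Φ
    rewrite expect-*ˡ xs c (λ R → Φ (x ∷ R)) | expect-*ˡ xs c (λ R D → Φ R (x ∷ D))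
    = lemma w c (expect w xs (λ R → Φ (x ∷ R))) _
    where
    lemma : ∀ w c a b → c * a + w * (c * b) ≡ c * (a + w * b)
    lemma = solve-∀

  expect-∑ : ∀ (xs : List A) (ys : List C) (Φ : C → List A → List A → ℕ) →
             expect w xs (λ R D → ∑[ y ∈ ys ] Φ y R D) ≡ (∑[ y ∈ ys ] expect w xs (Φ y))
  expect-∑ xs []       Φ = expect-0 xs
  expect-∑ xs (y ∷ ys) Φ = trans (expect-+ xs (Φ y) _) (cong (expect w xs (Φ y) ℕ.+_) (expect-∑ xs ys Φ))

  -- Method of conditional expectations: if neither keeping nor dropping `x` left a mean below `b`,
  -- the weighted sum of the two could not be below `b` either.
  below-average : ∀ (xs : List A) Φ b → expect w xs Φ < b * suc w ^ length xs →
                  ∃[ R ] ∃[ D ] Interleaving R D xs × Φ R D < b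
  below-average []       Φ b h = [] , [] , [] , subst (Φ [] [] <_) (ℕ.*-identityʳ b) h
  below-average (x ∷ xs) Φ b h
    with expect w xs (λ R → Φ (x ∷ R)) ℕ.<? b * suc w ^ length xs
  ... | yes h₁ = let R , D , p , lt = below-average xs _ b h₁ in x ∷ R , D , consˡ p , lt
  ... | no ¬h₁
    with expect w xs (λ R D → Φ R (x ∷ D)) ℕ.<? b * suc w ^ length xs
  ... | yes h₂ = let R , D , p , lt = below-average xs _ b h₂ in R , x ∷ D , consʳ p , lt
  ... | no ¬h₂ = contradiction h (ℕ.≤⇒≯ (begin
    b * (suc w * suc w ^ length xs)                           ≡⟨ lemma b w (suc w ^ length xs) ⟩
    b * suc w ^ length xs + w * (b * suc w ^ length xs)
      ≤⟨ ℕ.+-mono-≤ (ℕ.≮⇒≥ ¬h₁) (ℕ.*-monoʳ-≤ w (ℕ.≮⇒≥ ¬h₂)) ⟩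
    expect w (x ∷ xs) Φ ∎))
    where
    open ℕ.≤-Reasoning
    lemma : ∀ b w z → b * (suc w * z) ≡ b * z + w * (b * z)
    lemma = solve-∀

  module _ {P : Pred A 0ℓ} (P? : Decidable P) where

    -- Each element with `P` has to be kept, at a cost of 1/(1+w), and the other elements are free.
    -- The negative power of 1+w is moved to the left.
    expect-none-dropped : ∀ xs → suc w ^ count P? xs * expect w xs (λ R D → 𝟙 (count P? D ℕ.≟ 0))
                                 ≡ suc w ^ length xs
    expect-none-dropped []       = refl
    expect-none-dropped (x ∷ xs) with P? x | expect-none-dropped xs
    ... | yes _ | ih rewrite expect-0 xs | ℕ.*-zeroʳ w | sym ih =
      lemma (suc w) (suc w ^ count P? xs) (expect w xs (λ R D → 𝟙 (count P? D ℕ.≟ 0)))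
      where
      lemma : ∀ v c t → v * c * (t + 0) ≡ v * (c * t)
      lemma = solve-∀
    ... | no _  | ih rewrite sym ih =
      lemma w (suc w ^ count P? xs) (expect w xs (λ R D → 𝟙 (count P? D ℕ.≟ 0)))
      where
      lemma : ∀ w c t → c * (t + w * t) ≡ suc w * (c * t)
      lemma = solve-∀

    -- Markov's inequality for 2^-(number kept), whose mean is (1 - 1/(2(1+w)))^(count P? xs).
    expect-few-kept : ∀ xs a → expect w xs (λ R D → 𝟙 (count P? R ℕ.≤? a)) * (2 * suc w) ^ count P? xs
                               ≤ 2 ^ a * suc (2 * w) ^ count P? xs * suc w ^ length xs
    expect-few-kept []       a =
      ℕ.≤-trans (ℕ.*-monoˡ-≤ 1 (𝟙≤1 (0 ℕ.≤? a)))
        (ℕ.*-monoˡ-≤ 1 (ℕ.*-monoˡ-≤ 1 (ℕ.m^n>0 2 a)))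
    expect-few-kept (x ∷ xs) a with P? x
    expect-few-kept (x ∷ xs) a | no _ = begin
      (t + w * t) * c                 ≡⟨ lemma₁ t w c ⟩
      suc w * (t * c)                 ≤⟨ ℕ.*-monoʳ-≤ (suc w) (expect-few-kept xs a) ⟩
      suc w * (2 ^ a * b * l)         ≡⟨ lemma₂ (suc w) (2 ^ a * b) l ⟩
      2 ^ a * b * (suc w * l)         ∎
      where
      open ℕ.≤-Reasoning
      t = expect w xs (λ R D → 𝟙 (count P? R ℕ.≤? a))
      c = (2 * suc w) ^ count P? xs
      b = suc (2 * w) ^ count P? xs
      l = suc w ^ length xs
      lemma₁ : ∀ t w c → (t + w * t) * c ≡ suc w * (t * c)
      lemma₁ = solve-∀
      lemma₂ : ∀ v c l → v * (c * l) ≡ c * (v * l)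
      lemma₂ = solve-∀
    expect-few-kept (x ∷ xs) zero | yes _ = begin
      (expect w xs (λ R D → 𝟙 (suc (count P? R) ℕ.≤? 0)) + w * t) * (2 * suc w * c)
        ≡⟨ cong (λ z → (z + w * t) * (2 * suc w * c)) (expect-0 xs) ⟩
      w * t * (2 * suc w * c)         ≡⟨ lemma₁ w t c ⟩
      2 * w * suc w * (t * c)         ≤⟨ ℕ.*-mono-≤ (ℕ.*-monoˡ-≤ (suc w) (ℕ.n≤1+n (2 * w))) (expect-few-kept xs 0) ⟩
      suc (2 * w) * suc w * (1 * b * l) ≡⟨ lemma₂ (suc (2 * w)) (suc w) b l ⟩
      1 * (suc (2 * w) * b) * (suc w * l) ∎
      where
      open ℕ.≤-Reasoning
      t = expect w xs (λ R D → 𝟙 (count P? R ℕ.≤? 0))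
      c = (2 * suc w) ^ count P? xs
      b = suc (2 * w) ^ count P? xs
      l = suc w ^ length xs
      lemma₁ : ∀ w t c → w * t * (2 * suc w * c) ≡ 2 * w * suc w * (t * c)
      lemma₁ = solve-∀
      lemma₂ : ∀ u v b l → u * v * (1 * b * l) ≡ 1 * (u * b) * (v * l)
      lemma₂ = solve-∀
    expect-few-kept (x ∷ xs) (suc a) | yes _ = begin
      (expect w xs (λ R D → 𝟙 (suc (count P? R) ℕ.≤? suc a)) + w * t a⁺) * (2 * suc w * c)
        ≡⟨ cong (λ z → (z + w * t a⁺) * (2 * suc w * c))
             (expect-cong xs (λ R D → 𝟙-cong (suc (count P? R) ℕ.≤? suc a) (count P? R ℕ.≤? a) ℕ.s≤s⁻¹ s≤s)) ⟩
      (t a + w * t a⁺) * (2 * suc w * c)         ≡⟨ lemma₁ w (t a) (t a⁺) c ⟩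
      2 * suc w * (t a * c + w * (t a⁺ * c))
        ≤⟨ ℕ.*-monoʳ-≤ (2 * suc w) (ℕ.+-mono-≤ (expect-few-kept xs a) (ℕ.*-monoʳ-≤ w (expect-few-kept xs a⁺))) ⟩
      -- Keeping `x` uses up one of the `suc a` permitted elements, so the branches carry the
      -- factors 2^a and w * 2^(a+1), which add up to 2^a * (1 + 2w).
      2 * suc w * (2 ^ a * b * l + w * (2 * 2 ^ a * b * l)) ≡⟨ lemma₂ w (2 ^ a) b l ⟩
      2 * 2 ^ a * (suc (2 * w) * b) * (suc w * l) ∎
      where
      open ℕ.≤-Reasoning
      a⁺ = suc a
      t : ℕ → ℕ
      t a = expect w xs (λ R D → 𝟙 (count P? R ℕ.≤? a))
      c = (2 * suc w) ^ count P? xs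
      b = suc (2 * w) ^ count P? xs
      l = suc w ^ length xs
      lemma₁ : ∀ w s t c → (s + w * t) * (2 * suc w * c) ≡ 2 * suc w * (s * c + w * (t * c))
      lemma₁ = solve-∀
      lemma₂ : ∀ w p b l → 2 * suc w * (p * b * l + w * (2 * p * b * l)) ≡ 2 * p * (suc (2 * w) * b) * (suc w * l)
      lemma₂ = solve-∀

-- Powers of (1 + 1/y) and the lower tail of the number of kept elements

bernoulli : ∀ y k → y ^ suc k + suc k * y ^ k ≤ suc y ^ suc k
bernoulli y zero    = ℕ.≤-reflexive (lemma y)
  where
  lemma : ∀ y → y * 1 + 1 * 1 ≡ suc y * 1
  lemma = solve-∀
bernoulli y (suc k) = begin
  y * (y * z) + (2 + k) * (y * z)               ≤⟨ ℕ.m≤m+n _ (suc k * z) ⟩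
  y * (y * z) + (2 + k) * (y * z) + suc k * z   ≡⟨ lemma y z k ⟩
  suc y * (y * z + suc k * z)                   ≤⟨ ℕ.*-monoʳ-≤ (suc y) (bernoulli y k) ⟩
  suc y ^ suc (suc k)                           ∎
  where
  open ℕ.≤-Reasoning
  z = y ^ k
  lemma : ∀ y z k → y * (y * z) + (2 + k) * (y * z) + suc k * z ≡ suc y * (y * z + suc k * z)
  lemma = solve-∀

^-distrib-* : ∀ a b n → (a * b) ^ n ≡ a ^ n * b ^ n
^-distrib-* a b zero    = refl
^-distrib-* a b (suc n) rewrite ^-distrib-* a b n = lemma a b (a ^ n) (b ^ n)
  where
  lemma : ∀ a b c d → a * b * (c * d) ≡ a * c * (b * d)
  lemma = solve-∀

-- The first two terms of the binomial expansion of (1+y)^y are both y^y, so (1 + 1/y)^y ≥ 2. This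
-- is used t times; the remaining c - y * t factors are at least 1.
y^c*2^t≤1+y^c : ∀ y t c .{{_ : NonZero y}} → y * t ≤ c → y ^ c * 2 ^ t ≤ suc y ^ c
y^c*2^t≤1+y^c y@(suc z) t c yt≤c = begin
  y ^ c * 2 ^ t                             ≡⟨ cong (λ u → y ^ u * 2 ^ t) (sym (ℕ.m+[n∸m]≡n yt≤c)) ⟩
  y ^ (y * t + r) * 2 ^ t                   ≡⟨ cong (_* 2 ^ t) (ℕ.^-distribˡ-+-* y (y * t) r) ⟩
  y ^ (y * t) * y ^ r * 2 ^ t               ≡⟨ cong (λ u → u * y ^ r * 2 ^ t) (sym (ℕ.^-*-assoc y y t)) ⟩
  (y ^ y) ^ t * y ^ r * 2 ^ t               ≡⟨ lemma ((y ^ y) ^ t) (y ^ r) (2 ^ t) ⟩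
  2 ^ t * (y ^ y) ^ t * y ^ r               ≡⟨ cong (_* y ^ r) (sym (^-distrib-* 2 (y ^ y) t)) ⟩
  (2 * y ^ y) ^ t * y ^ r
    ≤⟨ ℕ.*-mono-≤ (ℕ.^-monoˡ-≤ t (ℕ.≤-trans (ℕ.≤-reflexive (lemma₂ (y ^ y))) (bernoulli y z))) (ℕ.^-monoˡ-≤ r (ℕ.n≤1+n y)) ⟩
  (suc y ^ y) ^ t * suc y ^ r               ≡⟨ cong (_* suc y ^ r) (ℕ.^-*-assoc (suc y) y t) ⟩
  suc y ^ (y * t) * suc y ^ r               ≡⟨ ℕ.^-distribˡ-+-* (suc y) (y * t) r ⟨
  suc y ^ (y * t + r)                       ≡⟨ cong (suc y ^_) (ℕ.m+[n∸m]≡n yt≤c) ⟩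
  suc y ^ c                                 ∎
  where
  open ℕ.≤-Reasoning
  r = c ∸ y * t
  lemma : ∀ a b c → a * b * c ≡ c * a * b
  lemma = solve-∀
  lemma₂ : ∀ a → 2 * a ≡ a + a
  lemma₂ = solve-∀

-- The mean number of kept elements is at least 2t, and (1 - 1/(2(1+w)))^count is at most 2^(-t).
-- The resulting tail 2^(a-t) is crude, but its exponential decay in t is what a union bound over
-- sets requires.
expect-few-kept-2^ : ∀ w {P : Pred A 0ℓ} (P? : Decidable P) xs a t → 2 * suc w * t ≤ count P? xs →
  expect w xs (λ R D → 𝟙 (count P? R ℕ.≤? a)) * 2 ^ t ≤ 2 ^ a * suc w ^ length xs
expect-few-kept-2^ w P? xs a t h = ℕ.*-cancelʳ-≤ _ _ (u ^ c) {{ℕ.m^n≢0 u c}} (begin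
  E * 2 ^ t * u ^ c                ≡⟨ lemma₁ E (2 ^ t) (u ^ c) ⟩
  E * u ^ c * 2 ^ t                ≤⟨ ℕ.*-monoˡ-≤ (2 ^ t) (expect-few-kept w P? xs a) ⟩
  2 ^ a * y ^ c * l * 2 ^ t        ≡⟨ lemma₂ (2 ^ a) (y ^ c) l (2 ^ t) ⟩
  2 ^ a * l * (y ^ c * 2 ^ t)      ≤⟨ ℕ.*-monoʳ-≤ (2 ^ a * l) (y^c*2^t≤1+y^c y t c yt≤c) ⟩
  2 ^ a * l * suc y ^ c            ≡⟨ cong (λ z → 2 ^ a * l * z ^ c) (sym u≡1+y) ⟩
  2 ^ a * l * u ^ c                ∎)
  where
  open ℕ.≤-Reasoning
  u = 2 * suc w
  y = suc (2 * w)
  u≡1+y : u ≡ suc y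
  u≡1+y = ℕ.*-suc 2 w
  c = count P? xs
  l = suc w ^ length xs
  E = expect w xs (λ R D → 𝟙 (count P? R ℕ.≤? a))
  yt≤c : y * t ≤ c
  yt≤c = ℕ.≤-trans (ℕ.*-monoˡ-≤ t (ℕ.≤-trans (ℕ.n≤1+n y) (ℕ.≤-reflexive (sym u≡1+y)))) h
  lemma₁ : ∀ a b c → a * b * c ≡ a * c * b
  lemma₁ = solve-∀
  lemma₂ : ∀ a b c d → a * b * c * d ≡ a * c * (b * d)
  lemma₂ = solve-∀

-- Colourings and degeneracy

lookup-injective : ∀ {xs : List A} → Unique xs → ∀ i j → lookup xs i ≡ lookup xs j → i ≡ j
lookup-injective (_ ∷ _)  zero    zero    _  = refl
lookup-injective (p ∷ _)  zero    (suc j) eq = contradiction eq (All.lookup p (∈-lookup j))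
lookup-injective (p ∷ _)  (suc i) zero    eq = contradiction (sym eq) (All.lookup p (∈-lookup i))
lookup-injective (_ ∷ ps) (suc i) (suc j) eq = cong suc (lookup-injective ps i j eq)

unique-⊆⇒length≤ : ∀ {xs ys : List A} → Unique xs → (∀ {x} → x ∈ xs → x ∈ ys) → length xs ≤ length ys
unique-⊆⇒length≤ {xs = xs} {ys} u sub = Fin.injective⇒≤ {f = λ i → Any.index (sub (∈-lookup i))} λ {i} {j} eq →
  lookup-injective u i j (trans (lookup-index (sub (∈-lookup i)))
    (trans (cong (lookup ys) eq) (sym (lookup-index (sub (∈-lookup j))))))

fresh : ∀ k (xs : List ℕ) → length xs < k → ∃[ c ] c < k × c ∉ xs
fresh k xs lt with Any.any? (λ c → ¬? (DecMembership._∈?_ ℕ._≟_ c xs)) (upTo k)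
... | yes p = let c , c∈ , c∉ = find p in c , ∈-upTo⁻ c∈ , c∉
... | no ¬p = contradiction
  (unique-⊆⇒length≤ (upTo⁺ k) λ c∈ → decidable-stable (DecMembership._∈?_ ℕ._≟_ _ xs) (All.lookup (¬Any⇒All¬ _ ¬p) c∈))
  (ℕ.<⇒≱ (subst (length xs <_) (sym (List.length-upTo k)) lt))

∑-tabulate-card : ∀ {n} (W : Subset n) (g : Fin n → A) f → (∀ i → f (g i) ≡ 𝟙 (i Sub.∈? W)) →
                  ∑ (tabulate g) f ≡ ∣ W ∣
∑-tabulate-card Vec.[]              g f h = refl
∑-tabulate-card (outside Vec.∷ W) g f h = cong₂ _+_ (h zero) (∑-tabulate-card W (g ∘ suc) f (h ∘ suc))
∑-tabulate-card (inside Vec.∷ W)  g f h = cong₂ _+_ (h zero) (∑-tabulate-card W (g ∘ suc) f (h ∘ suc))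

∣_∣≡∑ : ∀ {n} (W : Subset n) → (∑[ v ∈ allFin n ] 𝟙 (v Sub.∈? W)) ≡ ∣ W ∣
∣ W ∣≡∑ = ∑-tabulate-card W id _ (λ _ → refl)

subsets : ∀ {n} → Subset n → List (Subset n)
subsets Vec.[]              = Vec.[] ∷ []
subsets (outside Vec.∷ W) = map (outside Vec.∷_) (subsets W)
subsets (inside Vec.∷ W)  = map (outside Vec.∷_) (subsets W) ++ map (inside Vec.∷_) (subsets W)

length-subsets : ∀ {n} (W : Subset n) → length (subsets W) ≡ 2 ^ ∣ W ∣
length-subsets Vec.[]              = refl
length-subsets (outside Vec.∷ W) = trans (List.length-map _ (subsets W)) (length-subsets W)
length-subsets (inside Vec.∷ W)
  rewrite List.length-++ (map (outside Vec.∷_) (subsets W)) {map (inside Vec.∷_) (subsets W)}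
        | List.length-map (outside Vec.∷_) (subsets W) | List.length-map (inside Vec.∷_) (subsets W)
        | length-subsets W = cong (2 ^ ∣ W ∣ ℕ.+_) (sym (ℕ.+-identityʳ _))

∈-subsets : ∀ {n} {S W : Subset n} → S ⊆ˢ W → S ∈ subsets W
∈-subsets {S = Vec.[]}            {Vec.[]}            _   = here refl
∈-subsets {S = outside Vec.∷ S} {outside Vec.∷ W} S⊆W = ∈-map⁺ _ (∈-subsets (Sub.drop-∷-⊆ S⊆W))
∈-subsets {S = outside Vec.∷ S} {inside Vec.∷ W}  S⊆W = ∈-++⁺ˡ (∈-map⁺ _ (∈-subsets (Sub.drop-∷-⊆ S⊆W)))
∈-subsets {S = inside Vec.∷ S}  {inside Vec.∷ W}  S⊆W =
  ∈-++⁺ʳ (map (outside Vec.∷_) (subsets W)) (∈-map⁺ _ (∈-subsets (Sub.drop-∷-⊆ S⊆W)))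
∈-subsets {S = inside Vec.∷ S}  {outside Vec.∷ W} S⊆W with S⊆W Vec.here
... | ()

module _ {n} (P : Fin n → Fin n → Set) (P? : ∀ u v → Dec (P u v))
         (P-sym : ∀ {u v} → P u v → P v u) (P-irr : ∀ {u} → ¬ P u u) where

  -- An arbitrary symmetric irreflexive relation is allowed because the identity serves both for all
  -- of `J` and for the edges inside a set `S`.
  handshake : (∑[ u ∈ allFin n ] ∑[ v ∈ allFin n ] 𝟙 (P? u v))
              ≡ 2 * (∑[ u ∈ allFin n ] ∑[ v ∈ allFin n ] 𝟙 ((u Fin.<? v) ×-dec P? u v))
  handshake = begin
    (∑[ u ∈ allFin n ] ∑[ v ∈ allFin n ] 𝟙 (P? u v))
      ≡⟨ ∑-cong (allFin n) (λ u → trans (∑-cong (allFin n) (split u)) (∑-+ (allFin n) (up u) (λ v → up v u))) ⟩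
    (∑[ u ∈ allFin n ] ((∑[ v ∈ allFin n ] up u v) + (∑[ v ∈ allFin n ] up v u)))
      ≡⟨ ∑-+ (allFin n) _ _ ⟩
    U + (∑[ u ∈ allFin n ] ∑[ v ∈ allFin n ] up v u)
      ≡⟨ cong (U ℕ.+_) (∑-swap (allFin n) (allFin n) (λ u v → up v u)) ⟩
    U + U
      ≡⟨ cong (U ℕ.+_) (ℕ.+-identityʳ U) ⟨
    2 * U ∎
    where
    open ≡-Reasoning
    up : Fin n → Fin n → ℕ
    up u v = 𝟙 ((u Fin.<? v) ×-dec P? u v)
    U = ∑[ u ∈ allFin n ] ∑[ v ∈ allFin n ] up u v
    split : ∀ u v → 𝟙 (P? u v) ≡ up u v + up v u
    split u v with Fin.<-cmp u v
    ... | tri< u<v _ v≮u = trans (𝟙-cong (P? u v) ((u Fin.<? v) ×-dec P? u v) (u<v ,_) proj₂)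
      (trans (sym (ℕ.+-identityʳ _)) (cong (up u v ℕ.+_) (sym (𝟙-false ((v Fin.<? u) ×-dec P? v u) (v≮u ∘ proj₁)))))
    ... | tri≈ _ refl _  = trans (𝟙-false (P? u v) P-irr)
      (cong₂ _+_ (sym (𝟙-false ((u Fin.<? u) ×-dec P? u u) (P-irr ∘ proj₂))) (sym (𝟙-false ((u Fin.<? u) ×-dec P? u u) (P-irr ∘ proj₂))))
    ... | tri> u≮v _ v<u = trans (𝟙-cong (P? u v) ((v Fin.<? u) ×-dec P? v u) (λ p → v<u , P-sym p) (P-sym ∘ proj₂))
      (cong (_+ up v u) (sym (𝟙-false ((u Fin.<? v) ×-dec P? u v) (u≮v ∘ proj₁))))

module Colourings {n} (J : Graph n) where
  open Graph J using (_~_; _~?_; ~-sym; ~-irr)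

  degree : Subset n → Fin n → ℕ
  degree W v = ∑[ u ∈ allFin n ] 𝟙 ((u Sub.∈? W) ×-dec (v ~? u))

  -- Proper colourings of the induced subgraph J[W]. In contrast to `Colouring`, the colour does not
  -- take a proof of membership, so one function can be reused when `W` shrinks or grows.
  record Colourable (W : Subset n) (k : ℕ) : Set where
    constructor colouring
    field
      colour : Fin n → ℕ
      bound  : ∀ {v} → v ∈ˢ W → colour v < k
      proper : ∀ {u v} → u ∈ˢ W → v ∈ˢ W → u ~ v → colour u ≢ colour v

  extend : ∀ {W k v} → v ∈ˢ W → degree W v < k → Colourable (W - v) k → Colourable W k
  extend {W} {k} {v} v∈W deg<k (colouring c c< c≢) = colouring c′ c′< c′≢
    where
    nbr? : Decidable (λ u → (u ∈ˢ W) × v ~ u)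
    nbr? u = (u Sub.∈? W) ×-dec (v ~? u)
    used : List ℕ
    used = map c (filter nbr? (allFin n))
    new : ∃[ a ] a < k × a ∉ used
    new = fresh k used (subst (_< k) (sym (trans (List.length-map c (filter nbr? (allFin n))) (length-filter nbr? (allFin n)))) deg<k)
    a = proj₁ new
    a≢ : ∀ {u} → u ∈ˢ W → v ~ u → a ≢ c u
    a≢ u∈W v~u eq =
      proj₂ (proj₂ new) (subst (_∈ used) (sym eq) (∈-map⁺ c (∈-filter⁺ nbr? (∈-allFin _) (u∈W , v~u))))
    c′ : Fin n → ℕ
    c′ u = if does (u Fin.≟ v) then a else c u
    c′< : ∀ {u} → u ∈ˢ W → c′ u < k
    c′< {u} u∈W with u Fin.≟ v
    ... | yes _  = proj₁ (proj₂ new)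
    ... | no u≢v = c< (Sub.x∈p∧x≢y⇒x∈p-y u∈W u≢v)
    c′≢ : ∀ {u w} → u ∈ˢ W → w ∈ˢ W → u ~ w → c′ u ≢ c′ w
    c′≢ {u} {w} u∈W w∈W u~w with u Fin.≟ v | w Fin.≟ v
    ... | yes refl | yes refl = contradiction u~w (~-irr refl)
    ... | yes refl | no  w≢v  = a≢ w∈W u~w
    ... | no u≢v   | yes refl = a≢ u∈W (~-sym u~w) ∘ sym
    ... | no u≢v   | no w≢v   = c≢ (Sub.x∈p∧x≢y⇒x∈p-y u∈W u≢v) (Sub.x∈p∧x≢y⇒x∈p-y w∈W w≢v) u~w

  -- As long as some vertex has fewer than `k` neighbours in the current set, it is removed; put
  -- back in reverse order, each removed vertex finds a free colour among `k`. This is used twice: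
  -- with k = m - 1 to produce the set carrying the whole construction, and with k = s to colour a
  -- set spanning few edges.
  core : ∀ k W → ∃[ W′ ] W′ ⊆ˢ W × (∀ {v} → v ∈ˢ W′ → k ≤ degree W′ v) × (Colourable W′ k → Colourable W k)
  core k W = go W (<-wellFounded ∣ W ∣)
    where
    go : ∀ W → Acc _<_ ∣ W ∣ → ∃[ W′ ] W′ ⊆ˢ W × (∀ {v} → v ∈ˢ W′ → k ≤ degree W′ v) × (Colourable W′ k → Colourable W k)
    go W (acc rec) with Fin.any? (λ v → (v Sub.∈? W) ×-dec (degree W v ℕ.<? k))
    ... | yes (v , v∈W , deg<k) =
      let W′ , W′⊆ , deg≥ , col = go (W - v) (rec (Sub.x∈p⇒∣p-x∣<∣p∣ v∈W))
      in W′ , Sub.p─q⊆p W _ ∘ W′⊆ , deg≥ , extend v∈W deg<k ∘ col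
    ... | no ∄ = W , id , (λ v∈W → ℕ.≮⇒≥ (λ lt → ∄ (_ , v∈W , lt))) , id

  inside? : ∀ S → Decidable {A = Fin n × Fin n} (λ p → (proj₁ p ∈ˢ S) × (proj₂ p ∈ˢ S))
  inside? S p = (proj₁ p Sub.∈? S) ×-dec (proj₂ p Sub.∈? S)

  edges : List (Fin n × Fin n)
  edges = filter (λ p → (proj₁ p Fin.<? proj₂ p) ×-dec (proj₁ p ~? proj₂ p)) (cartesianProduct (allFin n) (allFin n))

  edge-count : ∀ S → 2 * count (inside? S) edges ≡ (∑[ v ∈ allFin n ] 𝟙 (v Sub.∈? S) * degree S v)
  edge-count S = begin
    2 * count (inside? S) edges
      ≡⟨ cong (2 *_) (trans (∑-filter _ (cartesianProduct (allFin n) (allFin n)) _) (∑-cartesianProduct (allFin n) (allFin n) _)) ⟩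
    2 * (∑[ u ∈ allFin n ] ∑[ v ∈ allFin n ] 𝟙 ((u Fin.<? v) ×-dec (u ~? v)) * 𝟙 ((u Sub.∈? S) ×-dec (v Sub.∈? S)))
      ≡⟨ cong (2 *_) (∑-cong (allFin n) λ u → ∑-cong (allFin n) λ v →
           trans (𝟙-× ((u Fin.<? v) ×-dec (u ~? v)) ((u Sub.∈? S) ×-dec (v Sub.∈? S))) (𝟙-cong (((u Fin.<? v) ×-dec (u ~? v)) ×-dec ((u Sub.∈? S) ×-dec (v Sub.∈? S))) ((u Fin.<? v) ×-dec P? u v)
             (λ ((u<v , u~v) , u∈ , v∈) → u<v , u∈ , v∈ , u~v) (λ (u<v , u∈ , v∈ , u~v) → (u<v , u~v) , u∈ , v∈))) ⟩
    2 * (∑[ u ∈ allFin n ] ∑[ v ∈ allFin n ] 𝟙 ((u Fin.<? v) ×-dec P? u v))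
      ≡⟨ handshake P P? (λ (u∈ , v∈ , u~v) → v∈ , u∈ , ~-sym u~v) (λ (_ , _ , u~u) → ~-irr refl u~u) ⟨
    (∑[ u ∈ allFin n ] ∑[ v ∈ allFin n ] 𝟙 (P? u v))
      ≡⟨ ∑-cong (allFin n) (λ u → trans (∑-cong (allFin n) (λ v → sym (𝟙-× (u Sub.∈? S) ((v Sub.∈? S) ×-dec (u ~? v))))) (∑-*ˡ (allFin n) (𝟙 (u Sub.∈? S)) _)) ⟩
    (∑[ v ∈ allFin n ] 𝟙 (v Sub.∈? S) * degree S v) ∎
    where
    open ≡-Reasoning
    P : Fin n → Fin n → Set
    P u v = (u ∈ˢ S) × (v ∈ˢ S) × u ~ v
    P? : ∀ u v → Dec (P u v)
    P? u v = (u Sub.∈? S) ×-dec ((v Sub.∈? S) ×-dec (u ~? v))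

  count-inside-mono : ∀ {S T} → S ⊆ˢ T → count (inside? S) edges ≤ count (inside? T) edges
  count-inside-mono S⊆T = ∑-mono edges (λ p _ → 𝟙-mono (inside? _ p) (inside? _ p) (λ (a , b) → S⊆T a , S⊆T b))

  min-degree⇒edges : ∀ {k W} → (∀ {v} → v ∈ˢ W → k ≤ degree W v) → k * ∣ W ∣ ≤ 2 * count (inside? W) edges
  min-degree⇒edges {k} {W} deg≥ = begin
    k * ∣ W ∣                                              ≡⟨ cong (k *_) ∣ W ∣≡∑ ⟨
    k * (∑[ v ∈ allFin n ] 𝟙 (v Sub.∈? W))                 ≡⟨ ∑-*ˡ (allFin n) k _ ⟨
    (∑[ v ∈ allFin n ] k * 𝟙 (v Sub.∈? W))                 ≤⟨ ∑-mono (allFin n) (λ v _ → pointwise v) ⟩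
    (∑[ v ∈ allFin n ] 𝟙 (v Sub.∈? W) * degree W v)        ≡⟨ edge-count W ⟨
    2 * count (inside? W) edges                            ∎
    where
    open ℕ.≤-Reasoning
    pointwise : ∀ v → k * 𝟙 (v Sub.∈? W) ≤ 𝟙 (v Sub.∈? W) * degree W v
    pointwise v with v Sub.∈? W
    ... | yes v∈W = ℕ.≤-trans (ℕ.≤-reflexive (ℕ.*-identityʳ k)) (ℕ.≤-trans (deg≥ v∈W) (ℕ.≤-reflexive (sym (ℕ.+-identityʳ _))))
    ... | no _    = ℕ.≤-reflexive (ℕ.*-zeroʳ k)

  degree≤∣∣ : ∀ W v → degree W v ≤ ∣ W ∣
  degree≤∣∣ W v = ℕ.≤-trans (∑-mono (allFin n) (λ u _ → 𝟙-mono ((u Sub.∈? W) ×-dec (v ~? u)) (u Sub.∈? W) proj₁))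
    (ℕ.≤-reflexive ∣ W ∣≡∑)

  -- A nonempty core of minimum degree `s` has at least `s` vertices, hence degree sum at least s *
  -- s, which is too much. So the core is empty and the greedy colouring takes over.
  few-edges⇒colourable : ∀ s W → 2 * count (inside? W) edges < s * s → Colourable W s
  few-edges⇒colourable s W few with core s W
  ... | W′ , W′⊆W , deg≥ , col with Sub.nonempty? W′
  ... | no empty = col (colouring (λ _ → 0) (λ v∈ → contradiction (_ , v∈) empty) (λ u∈ → contradiction (_ , u∈) empty))
  ... | yes (v , v∈W′) = contradiction few (ℕ.≤⇒≯ (begin
    s * s                          ≤⟨ ℕ.*-monoʳ-≤ s (ℕ.≤-trans (deg≥ v∈W′) (degree≤∣∣ W′ v)) ⟩
    s * ∣ W′ ∣                     ≤⟨ min-degree⇒edges deg≥ ⟩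
    2 * count (inside? W′) edges   ≤⟨ ℕ.*-monoʳ-≤ 2 (count-inside-mono W′⊆W) ⟩
    2 * count (inside? W) edges    ∎))
    where open ℕ.≤-Reasoning

-- Counting closed walks

sq-cancel-≤ : ∀ {a b} → a * a ≤ b * b → a ≤ b
sq-cancel-≤ a²≤b² = ℕ.≮⇒≥ λ b<a → ℕ.<⇒≱ (ℕ.*-mono-< b<a b<a) a²≤b²

-- This is the summation of f x ≤ g x * sqrt K with the square root removed. The cross term is
-- compared through its own square.
∑-sq : ∀ (xs : List A) f g K → (∀ x → f x * f x ≤ g x * g x * K) → ∑ xs f * ∑ xs f ≤ ∑ xs g * ∑ xs g * K
∑-sq []       f g K h = z≤n
∑-sq (x ∷ xs) f g K h = begin
  (a + F) * (a + F)                              ≡⟨ lemma₁ a F ⟩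
  a * a + 2 * (a * F) + F * F                    ≤⟨ ℕ.+-mono-≤ (ℕ.+-mono-≤ (h x) (ℕ.*-monoʳ-≤ 2 aF≤)) ih ⟩
  b * b * K + 2 * (b * G * K) + G * G * K        ≡⟨ lemma₂ b G K ⟩
  (b + G) * (b + G) * K                          ∎
  where
  open ℕ.≤-Reasoning
  a = f x
  b = g x
  F = ∑ xs f
  G = ∑ xs g
  ih = ∑-sq xs f g K h
  lemma₁ : ∀ a F → (a + F) * (a + F) ≡ a * a + 2 * (a * F) + F * F
  lemma₁ = solve-∀
  lemma₂ : ∀ b G K → b * b * K + 2 * (b * G * K) + G * G * K ≡ (b + G) * (b + G) * K
  lemma₂ = solve-∀
  lemma₃ : ∀ a F → a * F * (a * F) ≡ a * a * (F * F)
  lemma₃ = solve-∀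
  lemma₄ : ∀ b G K → b * b * K * (G * G * K) ≡ b * G * K * (b * G * K)
  lemma₄ = solve-∀
  aF≤ : a * F ≤ b * G * K
  aF≤ = sq-cancel-≤ (begin
    a * F * (a * F)             ≡⟨ lemma₃ a F ⟩
    a * a * (F * F)             ≤⟨ ℕ.*-mono-≤ (h x) ih ⟩
    b * b * K * (G * G * K)     ≡⟨ lemma₄ b G K ⟩
    b * G * K * (b * G * K)     ∎)

length-concatMap : ∀ (f : A → List C) xs → length (concatMap f xs) ≡ (∑[ x ∈ xs ] length (f x))
length-concatMap f []       = refl
length-concatMap f (x ∷ xs) = trans (List.length-++ (f x)) (cong (length (f x) ℕ.+_) (length-concatMap f xs))

length-cartesianProductWith : ∀ (f : A → C → X) xs ys → length (cartesianProductWith f xs ys) ≡ length xs * length ys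
length-cartesianProductWith f []       ys = refl
length-cartesianProductWith f (x ∷ xs) ys = trans (List.length-++ (map (f x) ys))
  (cong₂ _+_ (List.length-map (f x) ys) (length-cartesianProductWith f xs ys))

-- It unfolds by two successors, so induction on `j` matches stripping two vertices off a path.
twice : ℕ → ℕ
twice zero    = zero
twice (suc j) = suc (suc (twice j))

^-twice : ∀ a j → a ^ twice j ≡ a ^ j * a ^ j
^-twice a zero    = refl
^-twice a (suc j) rewrite ^-twice a j = lemma a (a ^ j)
  where
  lemma : ∀ a b → a * (a * (b * b)) ≡ a * b * (a * b)
  lemma = solve-∀

parity : ∀ l → (∃[ j ] l ≡ twice j) ⊎ (∃[ j ] l ≡ suc (twice j))
parity zero    = inj₁ (0 , refl)
parity (suc l) with parity l
... | inj₁ (j , refl) = inj₂ (j , refl)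
... | inj₂ (j , refl) = inj₁ (suc j , refl)

-- Closed walks and the edges they use

Path : {A : Set} → (A → A → Set) → A → List A → A → Set
Path _~_ x []       z = x ~ z
Path _~_ x (v ∷ vs) z = (x ~ v) × Path _~_ v vs z

path-map : ∀ {R S : A → A → Set} → (∀ {u v} → R u v → S u v) → ∀ x vs z → Path R x vs z → Path S x vs z
path-map f x []       z p       = f p
path-map f x (v ∷ vs) z (p , q) = f p , path-map f v vs z q

path-tabulate : ∀ (R : A → A → Set) {l} (c : Fin (suc l) → A) z → (∀ i → R (c (inject₁ i)) (c (suc i))) →
                R (c (fromℕ l)) z → Path R (c zero) (tabulate (c ∘ suc)) z
path-tabulate R {zero}  c z step last = last
path-tabulate R {suc l} c z step last = step zero , path-tabulate R (c ∘ suc) z (step ∘ suc) last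

cycle⇒path : ∀ {n} {G : Graph n} {l} → Cycle G (3 + l) →
             ∃[ v ] ∃[ vs ] length vs ≡ 2 + l × Unique (v ∷ vs) × Path (Graph._~_ G) v vs v
cycle⇒path {G = G} (cycle c inj step last) =
  c zero , tabulate (c ∘ suc) , List.length-tabulate (c ∘ suc) , tabulate⁺ inj ,
  path-tabulate (Graph._~_ G) c (c zero) step last

module _ {n : ℕ} where

  -- The representative of an undirected edge that occurs in `edges`, smaller end first; membership
  -- in a list of edges thus becomes equality of pairs.
  norm : Fin n → Fin n → Fin n × Fin n
  norm u v = if does (u Fin.<? v) then (u , v) else (v , u)

  Incident : Fin n → Fin n × Fin n → Set
  Incident x p = x ≡ proj₁ p ⊎ x ≡ proj₂ p

  incident-norm : ∀ {x} u v → x ≡ u ⊎ x ≡ v → Incident x (norm u v)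
  incident-norm u v x∈ with does (u Fin.<? v)
  incident-norm u v x∈       | true  = x∈
  incident-norm u v (inj₁ p) | false = inj₂ p
  incident-norm u v (inj₂ p) | false = inj₁ p

  norm-incident : ∀ {x} u v → Incident x (norm u v) → x ≡ u ⊎ x ≡ v
  norm-incident u v i with does (u Fin.<? v)
  norm-incident u v i        | true  = i
  norm-incident u v (inj₁ p) | false = inj₂ p
  norm-incident u v (inj₂ p) | false = inj₁ p

  steps : Fin n → List (Fin n) → Fin n → List (Fin n × Fin n)
  steps x []       z = norm x z ∷ []
  steps x (v ∷ vs) z = norm x v ∷ steps v vs z

  length-steps : ∀ x vs z → length (steps x vs z) ≡ suc (length vs)
  length-steps x []       z = refl
  length-steps x (v ∷ vs) z = cong suc (length-steps v vs z)

  path⇒steps : ∀ {R : Fin n → Fin n → Set} {Q : Fin n × Fin n → Set} → (∀ {u v} → R u v → Q (norm u v)) →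
               ∀ x vs z → Path R x vs z → All Q (steps x vs z)
  path⇒steps f x []       z p       = f p ∷ []
  path⇒steps f x (v ∷ vs) z (p , q) = f p ∷ path⇒steps f v vs z q

  steps-avoid : ∀ {y} x vs z → y ≢ x → All (y ≢_) vs → y ≢ z → All (λ p → ¬ Incident y p) (steps x vs z)
  steps-avoid x []       z y≢x _          y≢z = (λ i → Sum.[ y≢x , y≢z ] (norm-incident x z i)) ∷ []
  steps-avoid x (v ∷ vs) z y≢x (y≢v ∷ y∉) y≢z =
    (λ i → Sum.[ y≢x , y≢v ] (norm-incident x v i)) ∷ steps-avoid v vs z y≢v y∉ y≢z

  steps-unique : ∀ x vs z → Unique (x ∷ vs) → x ≢ z → All (_≢ z) vs → Unique (steps x vs z)
  steps-unique x []       z _                  x≢z _          = [] ∷ []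
  steps-unique x (v ∷ vs) z ((x≢v ∷ x∉) ∷ u) x≢z (v≢z ∷ ∌z) =
    All.map (λ ¬i eq → ¬i (subst (Incident x) eq (incident-norm x v (inj₁ refl))))
      (steps-avoid v vs z x≢v x∉ x≢z)
    ∷ steps-unique v vs z u v≢z ∌z

  -- The first and the last step share `z`, so the first step is told apart from all steps after the
  -- second by its other end `v`. A third vertex is indispensable: both steps of the closed walk z,
  -- v, z are the same edge. Distinctness is what makes survival of a cycle of length ℓ cost the
  -- full factor q^ℓ.
  closed-steps-unique : ∀ z vs → 2 ≤ length vs → Unique (z ∷ vs) → Unique (steps z vs z)
  closed-steps-unique z (v ∷ [])     (s≤s ()) _
  closed-steps-unique z (v ∷ w ∷ vs) _ ((z≢v ∷ z≢w ∷ z∉) ∷ u@((v≢w ∷ v∉) ∷ _)) =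
    ((λ eq → Sum.[ z≢v , z≢w ] (norm-incident v w (subst (Incident z) eq (incident-norm z v (inj₁ refl)))))
      ∷ All.map (λ ¬i eq → ¬i (subst (Incident v) eq (incident-norm z v (inj₂ refl))))
          (steps-avoid w vs z v≢w v∉ (z≢v ∘ sym)))
    ∷ steps-unique v (w ∷ vs) z u (z≢v ∘ sym) ((z≢w ∘ sym) ∷ All.map (λ p → p ∘ sym) z∉)

-- Lists that contain every closed walk of a given length

module Walks {n} (J : Graph n) where
  open Graph J using (_~_; _~?_; ~-sym; ~-irr)
  open Colourings J using (edges)

  neighbours : Fin n → List (Fin n)
  neighbours v = filter (v ~?_) (allFin n)

  d : Fin n → ℕ
  d v = length (neighbours v)

  darts : List (Fin n × Fin n)
  darts = filter (λ p → proj₁ p ~? proj₂ p) (cartesianProduct (allFin n) (allFin n))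

  ∈-neighbours : ∀ {u v} → u ~ v → v ∈ neighbours u
  ∈-neighbours u~v = ∈-filter⁺ (_ ~?_) (∈-allFin _) u~v

  ∈-darts : ∀ {u v} → u ~ v → (u , v) ∈ darts
  ∈-darts u~v = ∈-filter⁺ _ (∈-cartesianProduct⁺ (∈-allFin _) (∈-allFin _)) u~v

  length-darts : length darts ≡ (∑[ u ∈ allFin n ] ∑[ v ∈ allFin n ] 𝟙 (u ~? v))
  length-darts = trans (length-filter _ (cartesianProduct (allFin n) (allFin n))) (∑-cartesianProduct (allFin n) (allFin n) _)

  ∑-degrees : (∑[ v ∈ allFin n ] d v) ≡ length darts
  ∑-degrees = trans (∑-cong (allFin n) (λ v → length-filter (v ~?_) (allFin n))) (sym length-darts)

  darts≡2*edges : length darts ≡ 2 * length edges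
  darts≡2*edges = trans length-darts (trans (handshake _~_ _~?_ ~-sym (~-irr refl))
    (cong (2 *_) (sym (trans (length-filter _ (cartesianProduct (allFin n) (allFin n))) (∑-cartesianProduct (allFin n) (allFin n) _)))))

  norm∈edges : ∀ {u v} → u ~ v → norm u v ∈ edges
  norm∈edges {u} {v} u~v with Fin.<-cmp u v
  ... | tri< u<v _ _  rewrite dec-true (u Fin.<? v) u<v =
    ∈-filter⁺ _ (∈-cartesianProduct⁺ (∈-allFin u) (∈-allFin v)) (u<v , u~v)
  ... | tri≈ _ refl _ = contradiction u~v (~-irr refl)
  ... | tri> u≮v _ v<u rewrite dec-false (u Fin.<? v) u≮v =
    ∈-filter⁺ _ (∈-cartesianProduct⁺ (∈-allFin v) (∈-allFin u)) (v<u , ~-sym u~v)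

  edges-unique : Unique edges
  edges-unique = filter⁺ _ (cartesianProduct⁺ (allFin⁺ n) (allFin⁺ n))

  D : ℕ
  D = length darts

  -- Only every second adjacency of a walk is recorded: successive darts need not be joined. This
  -- overcounts, but makes the number of sequences a plain product, independent of the degrees.
  pairs : List (List (Fin n)) → ℕ → List (List (Fin n))
  pairs base zero    = base
  pairs base (suc j) = cartesianProductWith (λ p vs → proj₁ p ∷ proj₂ p ∷ vs) darts (pairs base j)

  length-pairs : ∀ base j → length (pairs base j) ≡ D ^ j * length base
  length-pairs base zero    = sym (ℕ.+-identityʳ _)
  length-pairs base (suc j) = trans (length-cartesianProductWith _ darts (pairs base j))
    (trans (cong (D *_) (length-pairs base j)) (sym (ℕ.*-assoc D (D ^ j) (length base))))

  even-path∈pairs : ∀ j {x vs z} → length vs ≡ twice j → Path _~_ x vs z → vs ∈ pairs ([] ∷ []) j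
  even-path∈pairs zero    {vs = []}          eq p               = here refl
  even-path∈pairs (suc j) {vs = u ∷ v ∷ vs} eq (_ , u~v , p) =
    ∈-cartesianProductWith⁺ _ (∈-darts u~v) (even-path∈pairs j (ℕ.suc-injective (ℕ.suc-injective eq)) p)

  odd-path∈pairs : ∀ j {x vs z} → length vs ≡ suc (twice j) → Path _~_ x vs z →
                   vs ∈ pairs (map (_∷ []) (neighbours z)) j
  odd-path∈pairs zero    {vs = u ∷ []}     eq (_ , u~z)     = ∈-map⁺ (_∷ []) (∈-neighbours (~-sym u~z))
  odd-path∈pairs (suc j) {vs = u ∷ v ∷ vs} eq (_ , u~v , p) =
    ∈-cartesianProductWith⁺ _ (∈-darts u~v) (odd-path∈pairs j (ℕ.suc-injective (ℕ.suc-injective eq)) p)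

  -- Here `l` counts the vertices after the base point, so the closed walks in question have length
  -- l + 1.
  Contains : ℕ → List (Fin n × List (Fin n)) → Set
  Contains l cs = ∀ v vs → length vs ≡ l → Path _~_ v vs v → (v , vs) ∈ cs

  -- Alternate edges of an even cycle cover each vertex once, so a cycle of length 2 + 2j is
  -- determined by 1 + j darts, the first of which starts at the base point.
  evenCycles : ℕ → List (Fin n × List (Fin n))
  evenCycles j = cartesianProductWith (λ p vs → proj₁ p , proj₂ p ∷ vs) darts (pairs ([] ∷ []) j)

  evenCycles-length : ∀ j → length (evenCycles j) * length (evenCycles j) ≡ D ^ (2 + twice j)
  evenCycles-length j = begin
    length (evenCycles j) * length (evenCycles j)
      ≡⟨ cong (λ z → z * z) (trans (length-cartesianProductWith _ darts (pairs ([] ∷ []) j))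
           (cong (D *_) (length-pairs ([] ∷ []) j))) ⟩
    D * (D ^ j * 1) * (D * (D ^ j * 1))   ≡⟨ lemma D (D ^ j) ⟩
    D * (D * (D ^ j * D ^ j))             ≡⟨ cong (λ z → D * (D * z)) (^-twice D j) ⟨
    D ^ (2 + twice j)                     ∎
    where
    open ≡-Reasoning
    lemma : ∀ a b → a * (b * 1) * (a * (b * 1)) ≡ a * (a * (b * b))
    lemma = solve-∀

  ∈-evenCycles : ∀ j → Contains (suc (twice j)) (evenCycles j)
  ∈-evenCycles j v (w ∷ vs) eq (v~w , p) =
    ∈-cartesianProductWith⁺ _ (∈-darts v~w) (even-path∈pairs j (ℕ.suc-injective eq) p)

  -- Choosing alternate edges leaves one vertex v of an odd cycle over; either v is
  -- added to the choice, or both neighbours of v replace one of the edges. Taking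
  -- the cheaper option at each v gains the factor (2e)^(1/2).
  oddCyclesAt : ℕ → Fin n → List (Fin n × List (Fin n))
  oddCyclesAt j v = map (v ,_)
    (if does (d v * d v ℕ.≤? D)
     then cartesianProductWith _∷_ (neighbours v) (pairs (map (_∷ []) (neighbours v)) j)
     else pairs ([] ∷ []) (suc j))

  oddCycles : ℕ → List (Fin n × List (Fin n))
  oddCycles j = concatMap (oddCyclesAt j) (allFin n)

  -- The list has min(d², D) * D^j entries with d = `d v`, and min(d², D) is at most the geometric
  -- mean d * D^(1/2). Being linear in d, this bound sums over v to D^(j+3/2).
  oddCyclesAt-length : ∀ j v → length (oddCyclesAt j v) * length (oddCyclesAt j v) ≤ d v * d v * D ^ (1 + twice j)
  oddCyclesAt-length j v with d v * d v ℕ.≤? D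
  ... | yes d²≤D rewrite dec-true (d v * d v ℕ.≤? D) d²≤D = begin
    length (map (v ,_) dense) * length (map (v ,_) dense)
      ≡⟨ cong (λ z → z * z) (trans (List.length-map (v ,_) dense)
           (trans (length-cartesianProductWith _∷_ (neighbours v) (pairs (map (_∷ []) (neighbours v)) j))
             (cong (δ *_) (trans (length-pairs (map (_∷ []) (neighbours v)) j)
               (cong (D ^ j *_) (List.length-map (_∷ []) (neighbours v))))))) ⟩
    δ * (D ^ j * δ) * (δ * (D ^ j * δ))        ≡⟨ lemma₁ δ (D ^ j) ⟩
    δ * δ * (δ * δ * (D ^ j * D ^ j))          ≤⟨ ℕ.*-monoʳ-≤ (δ * δ) (ℕ.*-monoˡ-≤ (D ^ j * D ^ j) d²≤D) ⟩
    δ * δ * (D * (D ^ j * D ^ j))              ≡⟨ cong (λ z → δ * δ * (D * z)) (^-twice D j) ⟨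
    δ * δ * D ^ (1 + twice j)                  ∎
    where
    open ℕ.≤-Reasoning
    δ = d v
    dense = cartesianProductWith _∷_ (neighbours v) (pairs (map (_∷ []) (neighbours v)) j)
    lemma₁ : ∀ a b → a * (b * a) * (a * (b * a)) ≡ a * a * (a * a * (b * b))
    lemma₁ = solve-∀
  ... | no d²≰D rewrite dec-false (d v * d v ℕ.≤? D) d²≰D = begin
    length (map (v ,_) (pairs ([] ∷ []) (suc j))) * length (map (v ,_) (pairs ([] ∷ []) (suc j)))
      ≡⟨ cong (λ z → z * z) (trans (List.length-map (v ,_) (pairs ([] ∷ []) (suc j))) (length-pairs ([] ∷ []) (suc j))) ⟩
    D * D ^ j * 1 * (D * D ^ j * 1)            ≡⟨ lemma₁ D (D ^ j) ⟩
    D * (D * (D ^ j * D ^ j))                  ≤⟨ ℕ.*-monoˡ-≤ (D * (D ^ j * D ^ j)) (ℕ.<⇒≤ (ℕ.≰⇒> d²≰D)) ⟩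
    d v * d v * (D * (D ^ j * D ^ j))          ≡⟨ cong (λ z → d v * d v * (D * z)) (^-twice D j) ⟨
    d v * d v * D ^ (1 + twice j)              ∎
    where
    open ℕ.≤-Reasoning
    lemma₁ : ∀ a b → a * b * 1 * (a * b * 1) ≡ a * (a * (b * b))
    lemma₁ = solve-∀

  oddCycles-length : ∀ j → length (oddCycles j) * length (oddCycles j) ≤ D ^ (3 + twice j)
  oddCycles-length j = begin
    length (oddCycles j) * length (oddCycles j)
      ≡⟨ cong (λ z → z * z) (length-concatMap (oddCyclesAt j) (allFin n)) ⟩
    ∑ (allFin n) (length ∘ oddCyclesAt j) * ∑ (allFin n) (length ∘ oddCyclesAt j)
      ≤⟨ ∑-sq (allFin n) _ d _ (oddCyclesAt-length j) ⟩
    ∑ (allFin n) d * ∑ (allFin n) d * D ^ (1 + twice j)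
      ≡⟨ cong (λ z → z * z * D ^ (1 + twice j)) ∑-degrees ⟩
    D * D * D ^ (1 + twice j)
      ≡⟨ ℕ.*-assoc D D (D ^ (1 + twice j)) ⟩
    D ^ (3 + twice j) ∎
    where open ℕ.≤-Reasoning

  ∈-oddCycles : ∀ j → Contains (2 + twice j) (oddCycles j)
  ∈-oddCycles j v vs eq p = ∈-concatMap⁺ (oddCyclesAt j) (lose (∈-allFin v) ∈at)
    where
    ∈at : (v , vs) ∈ oddCyclesAt j v
    ∈at with d v * d v ℕ.≤? D
    ... | no d²≰D rewrite dec-false (d v * d v ℕ.≤? D) d²≰D = ∈-map⁺ _ (even-path∈pairs (suc j) eq p)
    ... | yes d²≤D rewrite dec-true (d v * d v ℕ.≤? D) d²≤D = ∈-map⁺ _ (∈dense vs eq p)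
      where
      ∈dense : ∀ vs → length vs ≡ 2 + twice j → Path _~_ v vs v →
               vs ∈ cartesianProductWith _∷_ (neighbours v) (pairs (map (_∷ []) (neighbours v)) j)
      ∈dense (w ∷ vs) eq (v~w , p) =
        ∈-cartesianProductWith⁺ _ (∈-neighbours v~w) (odd-path∈pairs j (ℕ.suc-injective eq) p)

  closedWalks : ∀ l → ∃[ cs ] length cs * length cs ≤ D ^ (3 + l) × Contains (2 + l) cs
  closedWalks l with parity l
  -- The closed walks have length 3 + l, so an even `l` means an odd cycle.
  ... | inj₁ (j , refl) = oddCycles j , oddCycles-length j , ∈-oddCycles j
  ... | inj₂ (j , refl) = evenCycles (suc j) , ℕ.≤-reflexive (evenCycles-length (suc j)) , ∈-evenCycles (suc j)

-- Sampling and deletion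

∑-concatMap : ∀ (f : A → List C) xs g → ∑ (concatMap f xs) g ≡ (∑[ x ∈ xs ] ∑ (f x) g)
∑-concatMap f []       g = refl
∑-concatMap f (x ∷ xs) g = trans (∑-++ (f x) (concatMap f xs) g) (cong (∑ (f x) g ℕ.+_) (∑-concatMap f xs g))

module _ {A : Set} where
  kept⊆ : ∀ {R D L : List A} → Interleaving R D L → ∀ {x} → x ∈ R → x ∈ L
  kept⊆ (consˡ p) (here eq)   = here eq
  kept⊆ (consˡ p) (there x∈R) = there (kept⊆ p x∈R)
  kept⊆ (consʳ p) x∈R         = there (kept⊆ p x∈R)

  dropped⊆ : ∀ {R D L : List A} → Interleaving R D L → ∀ {x} → x ∈ D → x ∈ L
  dropped⊆ (consʳ p) (here eq)   = here eq
  dropped⊆ (consʳ p) (there x∈D) = there (dropped⊆ p x∈D)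
  dropped⊆ (consˡ p) x∈D         = there (dropped⊆ p x∈D)

  kept-unique : ∀ {R D L : List A} → Interleaving R D L → Unique L → Unique R
  kept-unique []        []       = []
  kept-unique (consˡ p) (x∉ ∷ u) = All.tabulate (λ y∈R → All.lookup x∉ (kept⊆ p y∈R)) ∷ kept-unique p u
  kept-unique (consʳ p) (_ ∷ u)  = kept-unique p u

  kept-dropped-disjoint : ∀ {R D L : List A} → Interleaving R D L → Unique L → ∀ {x} → x ∈ R → x ∉ D
  kept-dropped-disjoint (consˡ p) (x∉ ∷ u) (here refl) x∈D = All.lookup x∉ (dropped⊆ p x∈D) refl
  kept-dropped-disjoint (consˡ p) (_ ∷ u)  (there x∈R) x∈D = kept-dropped-disjoint p u x∈R x∈D
  kept-dropped-disjoint (consʳ p) (x∉ ∷ u) x∈R (here refl) = All.lookup x∉ (kept⊆ p x∈R) refl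
  kept-dropped-disjoint (consʳ p) (_ ∷ u)  x∈R (there x∈D) = kept-dropped-disjoint p u x∈R x∈D

-- The weight 1 + y lets a single average control two quantities at once: one sparse set alone would
-- already push the score to 1 + y.
weighted-< : ∀ y a b → suc y * a + b < suc y → a ≡ 0 × b ≤ y
weighted-< y zero    b lt = refl , ℕ.≤-pred (subst (λ z → z + b < suc y) (ℕ.*-zeroʳ (suc y)) lt)
weighted-< y (suc a) b lt = contradiction lt (ℕ.≤⇒≯ (ℕ.≤-trans (ℕ.m≤m*n (suc y) (suc a)) (ℕ.m≤m+n _ b)))

module _ {n} {P : Fin n → Set} (P? : Decidable P) where
  ⟦_⟧ : Subset n
  ⟦_⟧ = Vec.tabulate (does ∘ P?)

  ∈-⟦⟧⁺ : ∀ {v} → P v → v ∈ˢ ⟦_⟧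
  ∈-⟦⟧⁺ {v} p = Vec.lookup⇒[]= v ⟦_⟧ (trans (Vec.lookup∘tabulate (does ∘ P?) v) (dec-true (P? v) p))

  ∈-⟦⟧⁻ : ∀ {v} → v ∈ˢ ⟦_⟧ → P v
  ∈-⟦⟧⁻ {v} v∈ with P? v | trans (sym (Vec.lookup∘tabulate (does ∘ P?) v)) (Vec.[]=⇒lookup v∈)
  ... | yes p | _ = p
  ... | no _  | ()

norm-comm : ∀ {n} (u v : Fin n) → norm u v ≡ norm v u
norm-comm u v with Fin.<-cmp u v
... | tri< u<v _ v≮u rewrite dec-true (u Fin.<? v) u<v | dec-false (v Fin.<? u) v≮u = refl
... | tri≈ _ refl _  = refl
... | tri> u≮v _ v<u rewrite dec-true (v Fin.<? u) v<u | dec-false (u Fin.<? v) u≮v = refl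

norm-< : ∀ {n} {u v : Fin n} → u Fin.< v → norm u v ≡ (u , v)
norm-< {u = u} {v} u<v rewrite dec-true (u Fin.<? v) u<v = refl

*-+-mono-< : ∀ s {i j x} y → i < j → x < s → i * s + x < j * s + y
*-+-mono-< s {i} {j} {x} y i<j x<s = begin-strict
  i * s + x <⟨ ℕ.+-monoʳ-< (i * s) x<s ⟩
  i * s + s ≡⟨ ℕ.+-comm (i * s) s ⟩
  suc i * s ≤⟨ ℕ.*-monoˡ-≤ s i<j ⟩
  j * s     ≤⟨ ℕ.m≤m+n (j * s) y ⟩
  j * s + y ∎
  where open ℕ.≤-Reasoning

*-+-unique : ∀ s {i j x y} → x < s → y < s → i * s + x ≡ j * s + y → i ≡ j
*-+-unique s {i} {j} x<s y<s eq with ℕ.<-cmp i j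
... | tri< i<j _ _ = contradiction eq (ℕ.<⇒≢ (*-+-mono-< s _ i<j x<s))
... | tri≈ _ i≡j _ = i≡j
... | tri> _ _ j<i = contradiction (sym eq) (ℕ.<⇒≢ (*-+-mono-< s _ j<i y<s))

module _ {n} {G : Graph n} where
  open Graph G
  open Colourings G

  fromColouring : ∀ {j} → Colouring G j → Colourable V j
  fromColouring {j} (c , proper) = colouring c′ c′< c′≢
    where
    c′ : Fin n → ℕ
    c′ v with v Sub.∈? V
    ... | yes v∈ = toℕ (c v v∈)
    ... | no _   = 0
    c′≡ : ∀ {v} (v∈ : v ∈ˢ V) → c′ v ≡ toℕ (c v v∈)
    c′≡ {v} v∈ with v Sub.∈? V
    -- A colour formally depends on the membership proof; the proof found by the decision and the
    -- given one agree by irrelevance.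
    ... | yes v∈′ = cong (toℕ ∘ c v) ([]=-irrelevant v∈′ v∈)
    ... | no v∉   = contradiction v∈ v∉
    c′< : ∀ {v} → v ∈ˢ V → c′ v < j
    c′< v∈ = subst (_< j) (sym (c′≡ v∈)) (Fin.toℕ<n (c _ v∈))
    c′≢ : ∀ {u v} → u ∈ˢ V → v ∈ˢ V → u ~ v → c′ u ≢ c′ v
    c′≢ _ _ u~v eq = proper u~v (Fin.toℕ-injective
      (trans (sym (c′≡ (~-left u~v))) (trans eq (c′≡ (~-right u~v)))))

  toColouring : ∀ {j} → Colourable V j → Colouring G j
  toColouring (colouring c c< c≢) =
    (λ v v∈ → Fin.fromℕ< (c< v∈)) ,
    λ u~v eq → c≢ (~-left u~v) (~-right u~v) u~v
      (trans (sym (Fin.toℕ-fromℕ< (c< (~-left u~v)))) (trans (cong toℕ eq) (Fin.toℕ-fromℕ< (c< (~-right u~v)))))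

module _ {n} (J : Graph n) where
  open Graph J using (V; _~_; _~?_; ~-sym; ~-irr)
  open Colourings J
  open Walks J

  colourable-mono : ∀ {W i j} → i ≤ j → Colourable W i → Colourable W j
  colourable-mono i≤j (colouring c c< c≢) = colouring c (λ v∈ → ℕ.≤-trans (c< v∈) i≤j) c≢

  -- The new colour is the pair of the class and the colour inside the class, written as a two-digit
  -- number in base `s`.
  colourable-classes : ∀ {W j s} (c : Fin n → ℕ) → (∀ {v} → v ∈ˢ W → c v < j) →
    (∀ i → Colourable ⟦ (λ v → (v Sub.∈? W) ×-dec (c v ℕ.≟ i)) ⟧ s) → Colourable W (j * s)
  colourable-classes {W} {j} {s} c c< cls = colouring colour′ bound′ proper′
    where
    open Colourable
    class : ∀ i → Decidable (λ v → (v ∈ˢ W) × c v ≡ i)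
    class i v = (v Sub.∈? W) ×-dec (c v ℕ.≟ i)
    colour′ : Fin n → ℕ
    colour′ v = c v * s + colour (cls (c v)) v
    small : ∀ {v} → v ∈ˢ W → colour (cls (c v)) v < s
    small {v} v∈ = bound (cls (c v)) (∈-⟦⟧⁺ (class (c v)) (v∈ , refl))
    bound′ : ∀ {v} → v ∈ˢ W → colour′ v < j * s
    bound′ {v} v∈ = ℕ.≤-trans (ℕ.+-monoʳ-< (c v * s) (small v∈))
      (ℕ.≤-trans (ℕ.≤-reflexive (ℕ.+-comm (c v * s) s)) (ℕ.*-monoˡ-≤ s (c< v∈)))
    proper′ : ∀ {u v} → u ∈ˢ W → v ∈ˢ W → u ~ v → colour′ u ≢ colour′ v
    proper′ {u} {v} u∈ v∈ u~v eq with *-+-unique s (small u∈) (small v∈) eq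
    ... | cu≡cv = proper (cls (c v)) (∈-⟦⟧⁺ (class (c v)) (u∈ , cu≡cv)) (∈-⟦⟧⁺ (class (c v)) (v∈ , refl)) u~v
      (subst (λ i → colour (cls i) u ≡ colour (cls (c v)) v) cu≡cv
        (ℕ.+-cancelˡ-≡ (c v * s) _ _ (trans (cong (λ i → i * s + colour (cls (c u)) u) (sym cu≡cv)) eq)))

  -- The edge sacrificed to destroy a surviving cycle. In the degenerate case the value is a loop,
  -- which is never an edge, so deleting it is harmless.
  firstEdge : Fin n × List (Fin n) → Fin n × Fin n
  firstEdge (v , [])    = norm v v
  firstEdge (v , w ∷ _) = norm v w

  module Sampling (r s w y : ℕ) (W : Subset n) where

    q = suc w
    L = length edges

    infix 4 _∈ᴱ?_
    _∈ᴱ?_ : ∀ (p : Fin n × Fin n) ps → Dec (p ∈ ps)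
    _∈ᴱ?_ = DecMembership._∈?_ (≡-dec Fin._≟_ Fin._≟_)

    big : List (Subset n)
    big = filter (λ S → s * s ℕ.≤? 2 * count (inside? S) edges) (subsets W)

    Walk : Set
    Walk = Fin n × List (Fin n)

    on? : (x : Walk) → Decidable (_∈ steps (proj₁ x) (proj₂ x) (proj₁ x))
    on? (v , vs) p = p ∈ᴱ? steps v vs v

    -- The lists of `closedWalks` also hold sequences that are not walks or that repeat edges. The
    -- filter demands 3 + l distinct edges of `J`, so that survival has probability at most
    -- q^(-(3+l)).
    cyclesOfLength : ℕ → List Walk
    cyclesOfLength l = filter (λ x → 3 + l ℕ.≤? count (on? x) edges) (proj₁ (closedWalks l))

    -- The lengths 3 + l run through 3, ..., r - 1.
    shortCycles : List Walk
    shortCycles = concatMap cyclesOfLength (upTo (r ∸ 3))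

    sparseSets survivors : List (Fin n × Fin n) → List (Fin n × Fin n) → ℕ
    sparseSets R D = ∑[ S ∈ big ] 𝟙 (count (inside? S) R ℕ.≤? y)
    survivors  R D = ∑[ x ∈ shortCycles ] 𝟙 (count (on? x) D ℕ.≟ 0)

    module _ (1≤y : 1 ≤ y) (∣W∣≤4y : ∣ W ∣ ≤ 4 * y) (24qy≤s² : 24 * q * y ≤ s * s) where

      -- Origin of the constant 24: the tail bound with t = 6 * y needs 2 * q * 6 * y edges, twice
      -- that number is 24 * q * y, and `S` has at least s * s / 2 edges. The probability of at most
      -- `y` kept edges is then at most 2^(y - 6y).
      expect-sparseSet : ∀ S → S ∈ big →
        2 ^ (6 * y) * expect w edges (λ R D → 𝟙 (count (inside? S) R ℕ.≤? y)) ≤ 2 ^ y * q ^ L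
      expect-sparseSet S S∈ = ℕ.≤-trans (ℕ.≤-reflexive (ℕ.*-comm (2 ^ (6 * y)) _))
        (expect-few-kept-2^ w (inside? S) edges y (6 * y) (ℕ.*-cancelˡ-≤ 2 (begin
          2 * (2 * q * (6 * y))          ≡⟨ lemma q y ⟩
          24 * q * y                     ≤⟨ 24qy≤s² ⟩
          s * s                          ≤⟨ proj₂ (∈-filter⁻ (λ S → s * s ℕ.≤? 2 * count (inside? S) edges) {xs = subsets W} S∈) ⟩
          2 * count (inside? S) edges    ∎)))
        where
        open ℕ.≤-Reasoning
        lemma : ∀ q y → 2 * (2 * q * (6 * y)) ≡ 24 * q * y
        lemma = solve-∀

      -- At most 2^(4y) sets, each failing with probability at most 2^(-5y), leave a mean of 2^(-y)
      -- ≤ 1/2.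
      expect-sparseSets : 2 * expect w edges sparseSets ≤ q ^ L
      expect-sparseSets = ℕ.*-cancelˡ-≤ (2 ^ (5 * y)) {{ℕ.m^n≢0 2 (5 * y)}} (begin
        2 ^ (5 * y) * (2 * E)                     ≤⟨ ℕ.*-monoʳ-≤ (2 ^ (5 * y)) (ℕ.*-monoˡ-≤ E (ℕ.^-monoʳ-≤ 2 1≤y)) ⟩
        2 ^ (5 * y) * (2 ^ y * E)                 ≡⟨ ℕ.*-assoc (2 ^ (5 * y)) (2 ^ y) E ⟨
        2 ^ (5 * y) * 2 ^ y * E                   ≡⟨ cong (_* E) (ℕ.^-distribˡ-+-* 2 (5 * y) y) ⟨
        2 ^ (5 * y + y) * E                       ≡⟨ cong (λ z → 2 ^ z * E) (lemma₁ y) ⟩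
        2 ^ (6 * y) * E                           ≡⟨ cong (2 ^ (6 * y) *_) (expect-∑ w edges big _) ⟩
        2 ^ (6 * y) * (∑[ S ∈ big ] μ S)          ≡⟨ ∑-*ˡ big (2 ^ (6 * y)) μ ⟨
        (∑[ S ∈ big ] 2 ^ (6 * y) * μ S)          ≤⟨ ∑-mono big expect-sparseSet ⟩
        (∑[ S ∈ big ] 2 ^ y * q ^ L)              ≡⟨ ∑-const big _ ⟩
        length big * (2 ^ y * q ^ L)              ≤⟨ ℕ.*-monoˡ-≤ (2 ^ y * q ^ L) length-big ⟩
        2 ^ (4 * y) * (2 ^ y * q ^ L)             ≡⟨ ℕ.*-assoc (2 ^ (4 * y)) (2 ^ y) (q ^ L) ⟨
        2 ^ (4 * y) * 2 ^ y * q ^ L               ≡⟨ cong (_* q ^ L) (ℕ.^-distribˡ-+-* 2 (4 * y) y) ⟨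
        2 ^ (4 * y + y) * q ^ L                   ≡⟨ cong (λ z → 2 ^ z * q ^ L) (lemma₂ y) ⟩
        2 ^ (5 * y) * q ^ L                       ∎)
        where
        open ℕ.≤-Reasoning
        E = expect w edges sparseSets
        μ : Subset n → ℕ
        μ S = expect w edges (λ R D → 𝟙 (count (inside? S) R ℕ.≤? y))
        length-big : length big ≤ 2 ^ (4 * y)
        length-big = ℕ.≤-trans (List.length-filter _ (subsets W))
          (ℕ.≤-trans (ℕ.≤-reflexive (length-subsets W)) (ℕ.^-monoʳ-≤ 2 ∣W∣≤4y))
        lemma₁ : ∀ y → 5 * y + y ≡ 6 * y
        lemma₁ = solve-∀
        lemma₂ : ∀ y → 4 * y + y ≡ 5 * y
        lemma₂ = solve-∀

    module _ (3≤r : 3 ≤ r)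
             (few : ∀ l → 3 + l < r → 2 * r * (2 * r) * D ^ (3 + l) ≤ y * q ^ (3 + l) * (y * q ^ (3 + l))) where

      onCycle : Walk → ℕ
      onCycle x = expect w edges (λ R D → 𝟙 (count (on? x) D ℕ.≟ 0))

      expect-cycle : ∀ l x → x ∈ cyclesOfLength l → q ^ (3 + l) * onCycle x ≤ q ^ L
      expect-cycle l x x∈ = begin
        q ^ (3 + l) * onCycle x
          ≤⟨ ℕ.*-monoˡ-≤ (onCycle x) (ℕ.^-monoʳ-≤ q (proj₂ (∈-filter⁻ (λ x → 3 + l ℕ.≤? count (on? x) edges) {xs = proj₁ (closedWalks l)} x∈))) ⟩
        q ^ count (on? x) edges * onCycle x
          ≡⟨ expect-none-dropped w (on? x) edges ⟩
        q ^ L ∎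
        where open ℕ.≤-Reasoning

      few-cycles : ∀ l → 3 + l < r → 2 * r * length (cyclesOfLength l) ≤ y * q ^ (3 + l)
      few-cycles l l< = sq-cancel-≤ (begin
        2 * r * N * (2 * r * N)          ≡⟨ lemma (2 * r) N ⟩
        2 * r * (2 * r) * (N * N)        ≤⟨ ℕ.*-monoʳ-≤ (2 * r * (2 * r)) (ℕ.*-mono-≤ N≤ N≤) ⟩
        2 * r * (2 * r) * (length cs * length cs) ≤⟨ ℕ.*-monoʳ-≤ (2 * r * (2 * r)) (proj₁ (proj₂ (closedWalks l))) ⟩
        2 * r * (2 * r) * D ^ (3 + l)    ≤⟨ few l l< ⟩
        y * q ^ (3 + l) * (y * q ^ (3 + l)) ∎)
        where
        open ℕ.≤-Reasoning
        cs = proj₁ (closedWalks l)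
        N = length (cyclesOfLength l)
        N≤ : N ≤ length cs
        N≤ = List.length-filter _ cs
        lemma : ∀ a N → a * N * (a * N) ≡ a * a * (N * N)
        lemma = solve-∀

      expect-cyclesOfLength : ∀ l → 3 + l < r → 2 * r * ∑ (cyclesOfLength l) onCycle ≤ y * q ^ L
      expect-cyclesOfLength l l< = ℕ.*-cancelˡ-≤ (q ^ (3 + l)) {{ℕ.m^n≢0 q (3 + l)}} (begin
        p * (2 * r * ∑ cs onCycle)        ≡⟨ lemma₁ p (2 * r) (∑ cs onCycle) ⟩
        2 * r * (p * ∑ cs onCycle)        ≡⟨ cong (2 * r *_) (∑-*ˡ cs p onCycle) ⟨
        2 * r * (∑[ x ∈ cs ] p * onCycle x) ≤⟨ ℕ.*-monoʳ-≤ (2 * r) (∑-mono cs (expect-cycle l)) ⟩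
        2 * r * (∑[ x ∈ cs ] q ^ L)       ≡⟨ cong (2 * r *_) (∑-const cs (q ^ L)) ⟩
        2 * r * (length cs * q ^ L)       ≡⟨ ℕ.*-assoc (2 * r) (length cs) (q ^ L) ⟨
        2 * r * length cs * q ^ L         ≤⟨ ℕ.*-monoˡ-≤ (q ^ L) (few-cycles l l<) ⟩
        y * p * q ^ L                     ≡⟨ lemma₂ y p (q ^ L) ⟩
        p * (y * q ^ L)                   ∎)
        where
        open ℕ.≤-Reasoning
        p = q ^ (3 + l)
        cs = cyclesOfLength l
        lemma₁ : ∀ a b c → a * (b * c) ≡ b * (a * c)
        lemma₁ = solve-∀
        lemma₂ : ∀ a b c → a * b * c ≡ b * (a * c)
        lemma₂ = solve-∀

      -- There are fewer than `r` lengths, and each contributes at most y/(2r) to the mean.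
      expect-survivors : 2 * expect w edges survivors ≤ y * q ^ L
      expect-survivors = ℕ.*-cancelˡ-≤ r {{>-nonZero (ℕ.≤-trans (s≤s z≤n) 3≤r)}} (begin
        r * (2 * expect w edges survivors)       ≡⟨ lemma r _ ⟩
        2 * r * expect w edges survivors
          ≡⟨ cong (2 * r *_) (trans (expect-∑ w edges shortCycles _) (∑-concatMap cyclesOfLength (upTo (r ∸ 3)) onCycle)) ⟩
        2 * r * (∑[ l ∈ upTo (r ∸ 3) ] ∑ (cyclesOfLength l) onCycle)
          ≡⟨ ∑-*ˡ (upTo (r ∸ 3)) (2 * r) _ ⟨
        (∑[ l ∈ upTo (r ∸ 3) ] 2 * r * ∑ (cyclesOfLength l) onCycle)
          ≤⟨ ∑-mono (upTo (r ∸ 3)) (λ l l∈ → expect-cyclesOfLength l (short l l∈)) ⟩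
        (∑[ l ∈ upTo (r ∸ 3) ] y * q ^ L)        ≡⟨ ∑-const (upTo (r ∸ 3)) _ ⟩
        length (upTo (r ∸ 3)) * (y * q ^ L)      ≡⟨ cong (_* (y * q ^ L)) (List.length-upTo (r ∸ 3)) ⟩
        (r ∸ 3) * (y * q ^ L)                    ≤⟨ ℕ.*-monoˡ-≤ (y * q ^ L) (ℕ.m∸n≤m r 3) ⟩
        r * (y * q ^ L)                          ∎)
        where
        open ℕ.≤-Reasoning
        lemma : ∀ a b → a * (2 * b) ≡ 2 * a * b
        lemma = solve-∀
        short : ∀ l → l ∈ upTo (r ∸ 3) → 3 + l < r
        short l l∈ = subst (_≤ r) (ℕ.+-comm (suc l) 3) (ℕ.m≤o∸n⇒m+n≤o (suc l) 3≤r (∈-upTo⁻ l∈))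

      module _ (1≤y : 1 ≤ y) (∣W∣≤4y : ∣ W ∣ ≤ 4 * y) (24qy≤s² : 24 * q * y ≤ s * s) where

        score : List (Fin n × Fin n) → List (Fin n × Fin n) → ℕ
        score R X = suc y * sparseSets R X + survivors R X

        mean<1+y : expect w edges score < suc y * q ^ L
        mean<1+y = ℕ.*-cancelˡ-< 2 (expect w edges score) (suc y * q ^ L) (begin-strict
          2 * expect w edges score
            ≡⟨ cong (2 *_) (trans (expect-+ w edges (λ R X → suc y * sparseSets R X) survivors)
                 (cong (_+ expect w edges survivors) (expect-*ˡ w edges (suc y) sparseSets))) ⟩
          2 * (suc y * expect w edges sparseSets + expect w edges survivors)
            ≡⟨ lemma₁ (suc y) (expect w edges sparseSets) (expect w edges survivors) ⟩
          suc y * (2 * expect w edges sparseSets) + 2 * expect w edges survivors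
            ≤⟨ ℕ.+-mono-≤ (ℕ.*-monoʳ-≤ (suc y) (expect-sparseSets 1≤y ∣W∣≤4y 24qy≤s²)) expect-survivors ⟩
          suc y * q ^ L + y * q ^ L
            -- The halves (1 + y)/2 from the sparse sets and y/2 from the cycles add up to strictly
            -- less than 1 + y.
            <⟨ ℕ.+-monoʳ-< (suc y * q ^ L) (ℕ.*-monoˡ-< (q ^ L) {{ℕ.m^n≢0 q L}} (ℕ.n<1+n y)) ⟩
          suc y * q ^ L + suc y * q ^ L
            ≡⟨ cong (suc y * q ^ L ℕ.+_) (ℕ.+-identityʳ (suc y * q ^ L)) ⟨
          2 * (suc y * q ^ L) ∎)
          where
          open ℕ.≤-Reasoning
          lemma₁ : ∀ v a b → 2 * (v * a + b) ≡ v * (2 * a) + 2 * b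
          lemma₁ = solve-∀

        sample : ∃[ R ] ∃[ X ] Interleaving R X edges × sparseSets R X ≡ 0 × survivors R X ≤ y
        sample = let R , X , p , score< = below-average w edges score (suc y) mean<1+y
                 in R , X , p , weighted-< y (sparseSets R X) (survivors R X) score<

    module Alteration {R X} (p : Interleaving R X edges) (dense : sparseSets R X ≡ 0) (few-survive : survivors R X ≤ y) where

      surviving : List Walk
      surviving = filter (λ x → count (on? x) X ℕ.≟ 0) shortCycles

      deleted : List (Fin n × Fin n)
      deleted = map firstEdge surviving

      length-deleted : length deleted ≤ y
      length-deleted = ℕ.≤-trans (ℕ.≤-reflexive (trans (List.length-map firstEdge surviving) (length-filter _ shortCycles))) few-survive

      _~ᴴ_ : Fin n → Fin n → Set
      u ~ᴴ v = (u ∈ˢ W × v ∈ˢ W) × u ~ v × norm u v ∈ R × norm u v ∉ deleted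

      H : Graph n
      H = record
        { V      = W
        ; _~_    = _~ᴴ_
        ; _~?_   = λ u v → ((u Sub.∈? W) ×-dec (v Sub.∈? W)) ×-dec ((u ~? v) ×-dec ((norm u v ∈ᴱ? R) ×-dec ¬? (norm u v ∈ᴱ? deleted)))
        ; ~-sym  = λ {u} {v} ((u∈ , v∈) , u~v , kept , ∉del) →
            (v∈ , u∈) , ~-sym u~v , subst (_∈ R) (norm-comm u v) kept , subst (_∉ deleted) (norm-comm u v) ∉del
        ; ~-irr  = λ eq h → ~-irr eq (proj₁ (proj₂ h))
        ; ~-left = proj₁ ∘ proj₁
        }

      -- All edges of such a cycle lie in `R`, hence none in `X`, so the cycle is listed in
      -- `surviving` and its first edge was deleted. That edge cannot belong to `H`.
      no-short-cycle : ∀ l → Cycle H l → r ≤ l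
      no-short-cycle _ C@(cycle {l} _ _ _ _) = ℕ.≮⇒≥ λ 3+l<r → impossible 3+l<r (cycle⇒path C)
        where
        impossible : 3 + l < r → ¬ (∃[ v ] ∃[ vs ] length vs ≡ 2 + l × Unique (v ∷ vs) × Path _~ᴴ_ v vs v)
        impossible 3+l<r (v , vs@(v₁ ∷ vs′) , len , unique , path) =
          proj₂ (proj₂ (proj₂ (proj₁ path))) (∈-map⁺ firstEdge survives)
          where
          E = steps v vs v
          pathᴶ : Path _~_ v vs v
          pathᴶ = path-map (proj₁ ∘ proj₂) v vs v path
          E⊆edges : ∀ {e} → e ∈ E → e ∈ edges
          E⊆edges = All.lookup (path⇒steps norm∈edges v vs v pathᴶ)
          E⊆R : ∀ {e} → e ∈ E → e ∈ R
          E⊆R = All.lookup (path⇒steps (proj₁ ∘ proj₂ ∘ proj₂) v vs v path)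
          long : 3 + l ≤ count (on? (v , vs)) edges
          long = begin
            3 + l                                       ≡⟨ cong suc len ⟨
            suc (length vs)                             ≡⟨ length-steps v vs v ⟨
            length E
              ≤⟨ unique-⊆⇒length≤ (closed-steps-unique v vs (subst (2 ≤_) (sym len) (ℕ.m≤m+n 2 l)) unique)
                   (λ e∈ → ∈-filter⁺ (on? (v , vs)) (E⊆edges e∈) e∈) ⟩
            length (filter (on? (v , vs)) edges)        ≡⟨ length-filter (on? (v , vs)) edges ⟩
            count (on? (v , vs)) edges                  ∎
            where open ℕ.≤-Reasoning
          isShort : (v , vs) ∈ shortCycles
          isShort = ∈-concatMap⁺ cyclesOfLength (lose (∈-upTo⁺ (ℕ.m+n≤o⇒m≤o∸n (suc l) (subst (_≤ r) (ℕ.+-comm 3 (suc l)) 3+l<r)))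
            (∈-filter⁺ (λ x → 3 + l ℕ.≤? count (on? x) edges) (proj₂ (proj₂ (closedWalks l)) v vs len pathᴶ) long))
          survives : (v , vs) ∈ surviving
          survives = ∈-filter⁺ (λ x → count (on? x) X ℕ.≟ 0) isShort
            (count-none (on? (v , vs)) X (λ e e∈X e∈E → kept-dropped-disjoint p edges-unique (E⊆R e∈E) e∈X))

      -- All edges of `R` inside `S` must have been deleted, so there are at most `y` of them; a set
      -- spanning at least s * s / 2 edges of `J` would have kept more.
      independent⇒few-edges : ∀ {S} → S ⊆ˢ W → (∀ {u v} → u ∈ˢ S → v ∈ˢ S → ¬ u ~ᴴ v) →
                              2 * count (inside? S) edges < s * s
      independent⇒few-edges {S} S⊆W indep = ℕ.≰⇒> λ s²≤ → contradiction few-kept (ℕ.<⇒≱ (many-kept s²≤))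
        where
        kept : List (Fin n × Fin n)
        kept = filter (inside? S) R
        kept⊆deleted : ∀ {e} → e ∈ kept → e ∈ deleted
        kept⊆deleted {a , b} e∈ =
          let e∈R , a∈ , b∈ = ∈-filter⁻ (inside? S) {xs = R} e∈
              _ , a<b , a~b = ∈-filter⁻ _ {xs = cartesianProduct (allFin n) (allFin n)} (kept⊆ p e∈R)
          in decidable-stable ((a , b) ∈ᴱ? deleted) λ ∉del → indep a∈ b∈
               ((S⊆W a∈ , S⊆W b∈) , a~b , subst (_∈ R) (sym (norm-< a<b)) e∈R , subst (_∉ deleted) (sym (norm-< a<b)) ∉del)
        few-kept : count (inside? S) R ≤ y
        few-kept = ℕ.≤-trans (ℕ.≤-reflexive (sym (length-filter (inside? S) R)))
          (ℕ.≤-trans (unique-⊆⇒length≤ (filter⁺ (inside? S) (kept-unique p edges-unique)) kept⊆deleted) length-deleted)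
        many-kept : s * s ≤ 2 * count (inside? S) edges → y < count (inside? S) R
        many-kept s²≤ = ℕ.≰⇒> λ ≤y → ℕ.1+n≰n (begin
          1                                    ≡⟨ 𝟙-true (count (inside? S) R ℕ.≤? y) ≤y ⟨
          𝟙 (count (inside? S) R ℕ.≤? y)
            ≤⟨ term≤∑ big (λ S → 𝟙 (count (inside? S) R ℕ.≤? y)) (∈-filter⁺ (λ S → s * s ℕ.≤? 2 * count (inside? S) edges) (∈-subsets S⊆W) s²≤) ⟩
          sparseSets R X                       ≡⟨ dense ⟩
          0                                    ∎)
          where open ℕ.≤-Reasoning

      colouring-lifts : ∀ {j} → Colouring H j → Colourable W (j * s)
      colouring-lifts {j} colH = colourable-classes colour bound λ i →
        few-edges⇒colourable s _ (independent⇒few-edges (proj₁ ∘ ∈-⟦⟧⁻ (class i)) λ u∈ v∈ u~v →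
          proper (proj₁ (∈-⟦⟧⁻ (class i) u∈)) (proj₁ (∈-⟦⟧⁻ (class i) v∈)) u~v
            (trans (proj₂ (∈-⟦⟧⁻ (class i) u∈)) (sym (proj₂ (∈-⟦⟧⁻ (class i) v∈)))))
        where
        open Colourings.Colourable (fromColouring {G = H} colH)
        class : ∀ i → Decidable (λ v → (v ∈ˢ W) × colour v ≡ i)
        class i v = (v Sub.∈? W) ×-dec (colour v ℕ.≟ i)

  sparse-subgraph : ∀ (c k r s w y : ℕ) → ¬ Colourable V c → .{{_ : NonZero c}} → k * s ≤ c → 3 ≤ r → 1 ≤ y →
    2 * length edges ≤ c * (4 * y) → 24 * suc w * y ≤ s * s →
    (∀ l → 3 + l < r → 2 * r * (2 * r) * (2 * length edges) ^ (3 + l) ≤ y * suc w ^ (3 + l) * (y * suc w ^ (3 + l))) →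
    ∃[ H ] H ⊑ J × (∀ l → Cycle H l → r ≤ l) × (∀ j → Colouring H j → k < j)
  sparse-subgraph c k r s w y χ>c ks≤c 3≤r 1≤y 2e≤ 24qy≤s² few =
    H , (W⊆V , proj₁ ∘ proj₂) , no-short-cycle ,
    λ j colH → ℕ.≰⇒> λ j≤k → χ>c (col (colourable-mono (ℕ.≤-trans (ℕ.*-monoˡ-≤ s j≤k) ks≤c) (colouring-lifts colH)))
    where
    W = proj₁ (core c V)
    W⊆V = proj₁ (proj₂ (core c V))
    deg≥ = proj₁ (proj₂ (proj₂ (core c V)))
    col = proj₂ (proj₂ (proj₂ (core c V)))
    open Sampling r s w y W
    ∣W∣≤4y : ∣ W ∣ ≤ 4 * y
    ∣W∣≤4y = ℕ.*-cancelˡ-≤ c (ℕ.≤-trans (min-degree⇒edges deg≥)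
      (ℕ.≤-trans (ℕ.*-monoʳ-≤ 2 (ℕ.≤-trans (ℕ.≤-reflexive (sym (length-filter (inside? W) edges))) (List.length-filter (inside? W) edges))) 2e≤))
    outcome = sample 3≤r
      (λ l l< → subst (λ z → 2 * r * (2 * r) * z ^ (3 + l) ≤ y * suc w ^ (3 + l) * (y * suc w ^ (3 + l))) (sym darts≡2*edges) (few l l<))
      1≤y ∣W∣≤4y 24qy≤s²
    open Alteration (proj₁ (proj₂ (proj₂ outcome))) (proj₁ (proj₂ (proj₂ (proj₂ outcome)))) (proj₂ (proj₂ (proj₂ (proj₂ outcome))))

-- Existence of girth and chromatic number

least : ∀ {P : ℕ → Set} → Decidable P → ∀ N →
        (∃[ g ] P g × (∀ l → P l → g ≤ l)) ⊎ (∀ l → l < N → ¬ P l)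
least P? zero = inj₂ λ _ ()
least P? (suc N) with least P? N
... | inj₁ found = inj₁ found
... | inj₂ none with P? N
... | yes p = inj₁ (N , p , λ l pl → ℕ.≮⇒≥ (λ l<N → none l l<N pl))
... | no ¬p = inj₂ λ l l<1+N pl → none l (ℕ.≤∧≢⇒< (ℕ.≤-pred l<1+N) λ { refl → ¬p pl }) pl

-- Cycles and colourings are functions on finite sets; an exhaustive search is carried out on their
-- tables of values instead.
anyVec? : ∀ {m} n {Q : Vec (Fin m) n → Set} → Decidable Q → Dec (∃ Q)
anyVec? zero    Q? = map′ (Vec.[] ,_) (λ { (Vec.[] , q) → q }) (Q? Vec.[])
anyVec? (suc n) Q? = map′ (λ (x , xs , q) → x Vec.∷ xs , q) (λ { (x Vec.∷ xs , q) → x , xs , q })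
  (Fin.any? λ x → anyVec? n (λ xs → Q? (x Vec.∷ xs)))

module _ {n} (G : Graph n) where
  open Graph G
  open Colourings G

  cycle? : Decidable (Cycle G)
  cycle? 0 = no λ ()
  cycle? 1 = no λ ()
  cycle? 2 = no λ ()
  cycle? (suc (suc (suc l))) = map′ toCycle fromCycle (anyVec? (3 + l) isCycle?)
    where
    IsCycle : Vec (Fin n) (3 + l) → Set
    IsCycle c = (∀ i j → Vec.lookup c i ≡ Vec.lookup c j → i ≡ j)
              × (∀ i → Vec.lookup c (inject₁ i) ~ Vec.lookup c (suc i))
              × Vec.lookup c (fromℕ (2 + l)) ~ Vec.lookup c zero
    isCycle? : Decidable IsCycle
    isCycle? c = Fin.all? (λ i → Fin.all? λ j → (Vec.lookup c i Fin.≟ Vec.lookup c j) →-dec (i Fin.≟ j))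
      ×-dec (Fin.all? (λ i → Vec.lookup c (inject₁ i) ~? Vec.lookup c (suc i))
      ×-dec (Vec.lookup c (fromℕ (2 + l)) ~? Vec.lookup c zero))
    toCycle : ∃ IsCycle → Cycle G (3 + l)
    toCycle (c , inj , step , close) = cycle (Vec.lookup c) (inj _ _) step close
    fromCycle : Cycle G (3 + l) → ∃ IsCycle
    fromCycle (cycle c inj step close) = Vec.tabulate c ,
      (λ i j eq → inj (trans (sym (look i)) (trans eq (look j)))) ,
      (λ i → subst₂ _~_ (sym (look (inject₁ i))) (sym (look (suc i))) (step i)) ,
      subst₂ _~_ (sym (look (fromℕ (2 + l)))) (sym (look zero)) close
      where
      look : ∀ i → Vec.lookup (Vec.tabulate c) i ≡ c i
      look = Vec.lookup∘tabulate c

  girth-exists : ∃[ g ] girth[ G ]≡ g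
  girth-exists with least cycle? (suc n)
  ... | inj₁ (g , C , min) = [ g ] , C , min
  -- A cycle has at most `n` vertices, so searching all lengths up to `n` decides whether the girth
  -- is infinite.
  ... | inj₂ none          = ⊤⁺ , λ { l C@(cycle c inj _ _) → none l (s≤s (Fin.injective⇒≤ inj)) C }

  colouring? : Decidable (Colouring G)
  colouring? j = map′ fromVec toVec (anyVec? n isColouring?)
    where
    -- One spare colour, because vertices outside `V` need an entry too, even when j = 0. Inside `V`
    -- it is forbidden.
    IsColouring : Vec (Fin (suc j)) n → Set
    IsColouring c = (∀ v → v ∈ˢ V → toℕ (Vec.lookup c v) < j)
                  × (∀ u v → u ~ v → Vec.lookup c u ≢ Vec.lookup c v)
    isColouring? : Decidable IsColouring
    isColouring? c = Fin.all? (λ v → (v Sub.∈? V) →-dec (toℕ (Vec.lookup c v) ℕ.<? j))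
      ×-dec Fin.all? (λ u → Fin.all? λ v → (u ~? v) →-dec ¬? (Vec.lookup c u Fin.≟ Vec.lookup c v))
    fromVec : ∃ IsColouring → Colouring G j
    fromVec (c , c< , c≢) = toColouring {G = G} (colouring (toℕ ∘ Vec.lookup c) (c< _) λ _ _ u~v → c≢ _ _ u~v ∘ Fin.toℕ-injective)
    toVec : Colouring G j → ∃ IsColouring
    toVec colG = Vec.tabulate c′ ,
      (λ v v∈ → subst (_< j) (sym (c′≡ v∈)) (bound v∈)) ,
      λ u v u~v eq → proper (~-left u~v) (~-right u~v) u~v
        (trans (sym (c′≡ (~-left u~v))) (trans (cong toℕ eq) (c′≡ (~-right u~v))))
      where
      open Colourable (fromColouring {G = G} colG)
      c′ : Fin n → Fin (suc j)
      -- Truncating at `j` makes every value fit, including those outside `V`, where `colour` is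
      -- unconstrained; on `V` nothing changes.
      c′ v = Fin.fromℕ< (s≤s (ℕ.m⊓n≤n (colour v) j))
      c′≡ : ∀ {v} → v ∈ˢ V → toℕ (Vec.lookup (Vec.tabulate c′) v) ≡ colour v
      c′≡ {v} v∈ = trans (cong toℕ (Vec.lookup∘tabulate c′ v))
        (trans (Fin.toℕ-fromℕ< _) (ℕ.m≤n⇒m⊓n≡m (ℕ.<⇒≤ (bound v∈))))

  χ-exists : ∃[ c ] χ[ G ]≡ c
  χ-exists with least colouring? (suc n)
  ... | inj₁ (c , col , min) = c , col , min
  ... | inj₂ none = contradiction
    (toColouring {G = G} (colouring toℕ (λ {v} _ → Fin.toℕ<n v) λ _ _ u~v eq → ~-irr (Fin.toℕ-injective eq) u~v))
    (none n (ℕ.n<1+n n))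

≤-girth : ∀ {n} {G : Graph n} {r} → (∀ l → Cycle G l → r ≤ l) → ∃[ g ] girth[ G ]≡ g × [ r ] ≤⁺ g
≤-girth {G = G} r≤ with girth-exists G
... | [ g ] , C , min = [ g ] , (C , min) , [ r≤ g C ]
... | ⊤⁺ , none       = ⊤⁺ , none , (_ ≤⊤⁺)

-- Parameters

^-cancelʳ-≤ : ∀ n {a b} .{{_ : NonZero n}} → a ^ n ≤ b ^ n → a ≤ b
^-cancelʳ-≤ n aⁿ≤bⁿ = ℕ.≮⇒≥ λ b<a → ℕ.<⇒≱ (ℕ.^-monoˡ-< n b<a) aⁿ≤bⁿ

m<[1+m/n]*n : ∀ m n .{{_ : NonZero n}} → m < suc (m ℕ./ n) * n
m<[1+m/n]*n m n = begin-strict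
  m                           ≡⟨ ℕ.m≡m%n+[m/n]*n m n ⟩
  m ℕ.% n + m ℕ./ n * n       <⟨ ℕ.+-monoˡ-< (m ℕ./ n * n) (ℕ.m%n<n m n) ⟩
  n + m ℕ./ n * n             ∎
  where open ℕ.≤-Reasoning

-- The sampling probability is 1/(1+w); in few-walks both sides of
-- 2r (2E)^(ℓ/2) ≤ y (1+w)^ℓ are squared.
record Choice (k′ r m E : ℕ) : Set where
  field
    c s w y     : ℕ
    m≡1+c       : m ≡ suc c
    c-nonZero   : NonZero c
    1≤y         : 1 ≤ y
    k′s≤c       : k′ * s ≤ c
    2E≤4cy      : 2 * E ≤ c * (4 * y)
    24[1+w]y≤s² : 24 * suc w * y ≤ s * s
    few-walks   : ∀ l → 3 + l < r →
      2 * r * (2 * r) * (2 * E) ^ (3 + l) ≤ y * suc w ^ (3 + l) * (y * suc w ^ (3 + l))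

module Parameters (k′ r b d f : ℕ) .{{_ : NonZero d}} .{{_ : NonZero b}} (4≤r : 4 ≤ r) (fN<2d : f * (3 * r ∸ 5) < 2 * d) where

  -- The exponent is 2 + f/d. `K` is chosen for m² ≤ K * y * q, and `β` for y ≤ β * m^(1+f/d). `M₀`
  -- collects all constant factors and is a d-th power because only m^(1/d) is gained. The summands
  -- `k` and 2 in `M` guarantee m / k ≥ 1 and m - 1 ≥ 1.
  k K β M₀ M : ℕ
  k  = suc k′
  K  = 192 * (k * k)
  β  = 2 * b
  M₀ = (2 * r * (2 * r) * 2 ^ r * (K * K) ^ r * β ^ (3 * r)) ^ d
  M  = M₀ + k + 2

  module Absorption (m y : ℕ) .{{_ : NonZero m}} .{{_ : NonZero y}} (M₀≤m : M₀ ≤ m) (y^d≤ : y ^ d ≤ β ^ d * m ^ (d + f)) where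
    open ℕ.≤-Reasoning

    β-nonZero : NonZero β
    β-nonZero = ℕ.m*n≢0 2 b

    K-nonZero : NonZero (K * K)
    K-nonZero = ℕ.m*n≢0 K K

    instance
      r-nonZero : NonZero r
      r-nonZero = >-nonZero (ℕ.≤-trans (s≤s z≤n) 4≤r)

    -- y^t is of order m^(t + ft/d), and ft/d falls short of u by at least 1/d: this leaves
    -- a factor m^(1/d) for the constants.
    absorb : ∀ C t u → (C * β ^ t) ^ d ≤ m → f * t < u * d → C * y ^ t ≤ m ^ (t + u)
    absorb C t u C≤ ft<ud = ^-cancelʳ-≤ d (begin
      (C * y ^ t) ^ d                          ≡⟨ ^-distrib-* C (y ^ t) d ⟩
      C ^ d * (y ^ t) ^ d                      ≡⟨ cong (C ^ d *_) (swap-exponents y t d) ⟩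
      C ^ d * (y ^ d) ^ t                      ≤⟨ ℕ.*-monoʳ-≤ (C ^ d) (ℕ.^-monoˡ-≤ t y^d≤) ⟩
      C ^ d * (β ^ d * m ^ (d + f)) ^ t        ≡⟨ cong (C ^ d *_) (^-distrib-* (β ^ d) (m ^ (d + f)) t) ⟩
      C ^ d * ((β ^ d) ^ t * (m ^ (d + f)) ^ t) ≡⟨ ℕ.*-assoc (C ^ d) _ _ ⟨
      C ^ d * (β ^ d) ^ t * (m ^ (d + f)) ^ t  ≡⟨ cong₂ _*_ (cong (C ^ d *_) (swap-exponents β d t)) (ℕ.^-*-assoc m (d + f) t) ⟩
      C ^ d * (β ^ t) ^ d * m ^ ((d + f) * t)  ≡⟨ cong (_* m ^ ((d + f) * t)) (^-distrib-* C (β ^ t) d) ⟨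
      (C * β ^ t) ^ d * m ^ ((d + f) * t)      ≤⟨ ℕ.*-monoˡ-≤ (m ^ ((d + f) * t)) C≤ ⟩
      m ^ suc ((d + f) * t)                    ≤⟨ ℕ.^-monoʳ-≤ m exponents ⟩
      m ^ ((t + u) * d)                        ≡⟨ ℕ.^-*-assoc m (t + u) d ⟨
      (m ^ (t + u)) ^ d                        ∎)
      where
      swap-exponents : ∀ a i j → (a ^ i) ^ j ≡ (a ^ j) ^ i
      swap-exponents a i j = trans (ℕ.^-*-assoc a i j) (trans (cong (a ^_) (ℕ.*-comm i j)) (sym (ℕ.^-*-assoc a j i)))
      exponents : suc ((d + f) * t) ≤ (t + u) * d
      exponents = begin
        suc ((d + f) * t)     ≡⟨ lemma₁ d f t ⟩
        t * d + suc (f * t)   ≤⟨ ℕ.+-monoʳ-≤ (t * d) ft<ud ⟩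
        t * d + u * d         ≡⟨ ℕ.*-distribʳ-+ d t u ⟨
        (t + u) * d           ∎
        where
        lemma₁ : ∀ d f t → suc ((d + f) * t) ≡ t * d + suc (f * t)
        lemma₁ = solve-∀

    1≤[2r]² : 1 ≤ 2 * r * (2 * r)
    1≤[2r]² = ℕ.*-mono-≤ (ℕ.*-mono-≤ (s≤s {n = 1} z≤n) (ℕ.>-nonZero⁻¹ r)) (ℕ.*-mono-≤ (s≤s {n = 1} z≤n) (ℕ.>-nonZero⁻¹ r))

    absorbable : ∀ ℓ t → ℓ ≤ r → t ≤ 3 * r → (2 * r * (2 * r) * 2 ^ ℓ * (K * K) ^ ℓ * β ^ t) ^ d ≤ m
    absorbable ℓ t ℓ≤r t≤3r = ℕ.≤-trans (ℕ.^-monoˡ-≤ d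
      (ℕ.*-mono-≤ (ℕ.*-mono-≤ (ℕ.*-monoʳ-≤ (2 * r * (2 * r)) (ℕ.^-monoʳ-≤ 2 ℓ≤r)) (ℕ.^-monoʳ-≤ (K * K) {{K-nonZero}} ℓ≤r))
                  (ℕ.^-monoʳ-≤ β {{β-nonZero}} t≤3r))) M₀≤m

    -- As f < d, the order m^(1+f/d) of `y` is below m². This is needed for 24 * y ≤ s * s, that is,
    -- for a positive `q`.
    Ky≤m² : K * y ≤ m * m
    Ky≤m² = begin
      K * y          ≡⟨ cong (K *_) (ℕ.^-identityʳ y) ⟨
      K * y ^ 1      ≤⟨ absorb K 1 1 K≤ (ℕ.≤-trans (s≤s (ℕ.≤-reflexive (ℕ.*-identityʳ f))) (ℕ.≤-trans f<d (ℕ.≤-reflexive (sym (ℕ.+-identityʳ d))))) ⟩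
      m * (m * 1)    ≡⟨ cong (m *_) (ℕ.*-identityʳ m) ⟩
      m * m          ∎
      where
      f<d : f < d
      f<d = ℕ.*-cancelˡ-< 2 f d (ℕ.≤-trans (s≤s (ℕ.≤-trans (ℕ.≤-reflexive (ℕ.*-comm 2 f))
        (ℕ.*-monoʳ-≤ f (ℕ.≤-trans (ℕ.m≤n+m 2 5) (ℕ.∸-monoˡ-≤ 5 (ℕ.*-monoʳ-≤ 3 4≤r)))))) fN<2d)
      K≤ : (K * β ^ 1) ^ d ≤ m
      K≤ = ℕ.≤-trans (ℕ.^-monoˡ-≤ d (ℕ.*-monoˡ-≤ (β ^ 1) (begin
        K                                        ≤⟨ ℕ.m≤m*n K K ⟩
        K * K                                    ≤⟨ ℕ.m≤n*m (K * K) (2 * r * (2 * r) * 2) {{ℕ.m*n≢0 (2 * r * (2 * r)) 2 {{>-nonZero 1≤[2r]²}}}} ⟩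
        2 * r * (2 * r) * 2 * (K * K)            ≡⟨ cong₂ _*_ (cong (2 * r * (2 * r) *_) (ℕ.^-identityʳ 2)) (ℕ.^-identityʳ (K * K)) ⟨
        2 * r * (2 * r) * 2 ^ 1 * (K * K) ^ 1    ∎)))
        (absorbable 1 1 (ℕ.>-nonZero⁻¹ r) (ℕ.≤-trans (ℕ.>-nonZero⁻¹ r) (ℕ.m≤n*m r 3)))

    -- Multiplying both sides by (K * y)^(2ℓ) turns the lower bound m²/(K * y) for `q` into a
    -- division-free one. What remains is a constant times y^(3ℓ-2) ≤ m^(3ℓ), and `absorb` yields it
    -- from f * (3ℓ-2) < 2d, whose extreme case ℓ = r - 1 is the hypothesis `fN<2d`.
    few : ∀ E q → E ≤ m * y → m * m ≤ K * y * q → ∀ l → 3 + l < r → 2 * r * (2 * r) * (2 * E) ^ (3 + l) ≤ y * q ^ (3 + l) * (y * q ^ (3 + l))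
    few E q E≤my m²≤Kyq l ℓ<r = ℕ.*-cancelʳ-≤ _ _ (Z * Z) {{ℕ.m*n≢0 Z Z {{Z≢0}} {{Z≢0}}}} (begin
        R * (2 * E) ^ ℓ * (Z * Z)
          ≤⟨ ℕ.*-monoˡ-≤ (Z * Z) (ℕ.*-monoʳ-≤ R (ℕ.^-monoˡ-≤ ℓ (ℕ.*-monoʳ-≤ 2 E≤my))) ⟩
        R * (2 * (m * y)) ^ ℓ * (Z * Z)
          ≡⟨ cong₂ (λ u v → R * u * (v * v)) (trans (^-distrib-* 2 (m * y) ℓ) (cong (2 ^ ℓ *_) (^-distrib-* m y ℓ))) (^-distrib-* K y ℓ) ⟩
        R * (2 ^ ℓ * (m ^ ℓ * y ^ ℓ)) * (K ^ ℓ * y ^ ℓ * (K ^ ℓ * y ^ ℓ))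
          ≡⟨ lemma₁ R (2 ^ ℓ) (m ^ ℓ) (y ^ ℓ) (K ^ ℓ) ⟩
        R * 2 ^ ℓ * (K ^ ℓ * K ^ ℓ) * (y ^ ℓ * (y ^ ℓ * y ^ ℓ)) * m ^ ℓ
          ≡⟨ cong₂ (λ u v → R * 2 ^ ℓ * u * v * m ^ ℓ) (sym (^-distrib-* K K ℓ)) y^3ℓ ⟩
        R * 2 ^ ℓ * (K * K) ^ ℓ * (y * y * y ^ t) * m ^ ℓ
          ≡⟨ lemma₂ (R * 2 ^ ℓ * (K * K) ^ ℓ) y (y ^ t) (m ^ ℓ) ⟩
        y * y * (R * 2 ^ ℓ * (K * K) ^ ℓ * y ^ t) * m ^ ℓ
          ≤⟨ ℕ.*-monoˡ-≤ (m ^ ℓ) (ℕ.*-monoʳ-≤ (y * y) (absorb (R * 2 ^ ℓ * (K * K) ^ ℓ) t 2 (absorbable ℓ t (ℕ.<⇒≤ ℓ<r) t≤3r) ft<2d)) ⟩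
        y * y * m ^ (t + 2) * m ^ ℓ
          ≡⟨ trans (ℕ.*-assoc (y * y) (m ^ (t + 2)) (m ^ ℓ)) (cong (y * y *_) (sym (ℕ.^-distribˡ-+-* m (t + 2) ℓ))) ⟩
        y * y * m ^ (t + 2 + ℓ)
          ≡⟨ cong (λ z → y * y * m ^ z) (lemma₃ l) ⟩
        y * y * m ^ ((ℓ + ℓ) + (ℓ + ℓ))
          ≡⟨ cong (y * y *_) m^4ℓ ⟩
        y * y * ((m * m) ^ ℓ * (m * m) ^ ℓ)
          ≤⟨ ℕ.*-monoʳ-≤ (y * y) (ℕ.*-mono-≤ (ℕ.^-monoˡ-≤ ℓ m²≤Kyq) (ℕ.^-monoˡ-≤ ℓ m²≤Kyq)) ⟩
        y * y * ((K * y * q) ^ ℓ * (K * y * q) ^ ℓ)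
          ≡⟨ cong (λ z → y * y * (z * z)) (^-distrib-* (K * y) q ℓ) ⟩
        y * y * (Z * q ^ ℓ * (Z * q ^ ℓ))
          ≡⟨ lemma₄ y Z (q ^ ℓ) ⟩
        y * q ^ ℓ * (y * q ^ ℓ) * (Z * Z) ∎)
      where
      ℓ = 3 + l
      -- This is 3ℓ - 2: two of the 3ℓ factors `y` are matched by the `y * y` on the right-hand
      -- side.
      t = 7 + 3 * l
      R = 2 * r * (2 * r)
      Z = (K * y) ^ ℓ
      Z≢0 : NonZero Z
      Z≢0 = ℕ.m^n≢0 (K * y) ℓ {{ℕ.m*n≢0 K y}}
      t≤3r-5 : t ≤ 3 * r ∸ 5
      t≤3r-5 = begin
        7 + 3 * l               ≡⟨ ℕ.m+n∸n≡m (7 + 3 * l) 5 ⟨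
        7 + 3 * l + 5 ∸ 5       ≡⟨ cong (_∸ 5) (lemma l) ⟩
        3 * (4 + l) ∸ 5         ≤⟨ ℕ.∸-monoˡ-≤ 5 (ℕ.*-monoʳ-≤ 3 ℓ<r) ⟩
        3 * r ∸ 5               ∎
        where
        lemma : ∀ l → 7 + 3 * l + 5 ≡ 3 * (4 + l)
        lemma = solve-∀
      t≤3r : t ≤ 3 * r
      t≤3r = ℕ.≤-trans t≤3r-5 (ℕ.m∸n≤m (3 * r) 5)
      ft<2d : f * t < 2 * d
      ft<2d = ℕ.≤-trans (s≤s (ℕ.*-monoʳ-≤ f t≤3r-5)) fN<2d
      y^3ℓ : y ^ ℓ * (y ^ ℓ * y ^ ℓ) ≡ y * y * y ^ t
      y^3ℓ = trans (cong (y ^ ℓ *_) (sym (ℕ.^-distribˡ-+-* y ℓ ℓ)))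
        (trans (sym (ℕ.^-distribˡ-+-* y ℓ (ℓ + ℓ))) (trans (cong (y ^_) (lemma l)) (sym (ℕ.*-assoc y y (y ^ t)))))
        where
        lemma : ∀ l → 3 + l + (3 + l + (3 + l)) ≡ 2 + (7 + 3 * l)
        lemma = solve-∀
      m^4ℓ : m ^ ((ℓ + ℓ) + (ℓ + ℓ)) ≡ (m * m) ^ ℓ * (m * m) ^ ℓ
      m^4ℓ = trans (ℕ.^-distribˡ-+-* m (ℓ + ℓ) (ℓ + ℓ)) (cong (λ z → z * z)
        (trans (ℕ.^-distribˡ-+-* m ℓ ℓ) (sym (^-distrib-* m m ℓ))))
      lemma₁ : ∀ R a m y K → R * (a * (m * y)) * (K * y * (K * y)) ≡ R * a * (K * K) * (y * (y * y)) * m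
      lemma₁ = solve-∀
      lemma₂ : ∀ C y z m → C * (y * y * z) * m ≡ y * y * (C * z) * m
      lemma₂ = solve-∀
      lemma₃ : ∀ l → 7 + 3 * l + 2 + (3 + l) ≡ (3 + l + (3 + l)) + (3 + l + (3 + l))
      lemma₃ = solve-∀
      lemma₄ : ∀ y Z q → y * y * (Z * q * (Z * q)) ≡ y * q * (y * q) * (Z * Z)
      lemma₄ = solve-∀

  module _ (m E : ℕ) (M≤m : M ≤ m) (E^d≤ : E ^ d ≤ b ^ d * m ^ (2 * d + f)) where
    open ℕ.≤-Reasoning

    2≤m : 2 ≤ m
    2≤m = ℕ.≤-trans (ℕ.m≤n+m 2 (M₀ + k)) M≤m

    k≤m : k ≤ m
    k≤m = ℕ.≤-trans (ℕ.≤-trans (ℕ.m≤n+m k M₀) (ℕ.m≤m+n (M₀ + k) 2)) M≤m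

    M₀≤m : M₀ ≤ m
    M₀≤m = ℕ.≤-trans (ℕ.≤-trans (ℕ.m≤m+n M₀ k) (ℕ.m≤m+n (M₀ + k) 2)) M≤m

    instance
      m-nonZero : NonZero m
      m-nonZero = >-nonZero (ℕ.≤-trans (s≤s z≤n) 2≤m)

    c s y : ℕ
    c = pred m
    s = m ℕ./ k
    -- Rounding up secures both E ≤ m * y and y ≥ 1.
    y = suc (E ℕ./ m)

    m≡1+c : m ≡ suc c
    m≡1+c = sym (ℕ.suc-pred m)

    1≤c : 1 ≤ c
    1≤c = ℕ.≤-pred (subst (2 ≤_) m≡1+c 2≤m)

    E≤my : E ≤ m * y
    E≤my = ℕ.≤-trans (ℕ.<⇒≤ (m<[1+m/n]*n E m)) (ℕ.≤-reflexive (ℕ.*-comm y m))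

    2E≤4cy : 2 * E ≤ c * (4 * y)
    2E≤4cy = begin
      2 * E            ≤⟨ ℕ.*-monoʳ-≤ 2 E≤my ⟩
      2 * (m * y)      ≡⟨ cong (λ z → 2 * (z * y)) m≡1+c ⟩
      2 * ((1 + c) * y) ≤⟨ ℕ.*-monoʳ-≤ 2 (ℕ.*-monoˡ-≤ y (ℕ.+-monoˡ-≤ c 1≤c)) ⟩
      2 * ((c + c) * y) ≡⟨ lemma c y ⟩
      c * (4 * y)      ∎
      where
      lemma : ∀ c y → 2 * ((c + c) * y) ≡ c * (4 * y)
      lemma = solve-∀

    -- Rounding costs m * y ≤ m + E ≤ 2 * max(m, E), the source of the 2 in `β`. The edge bound
    -- holds for `m` in place of `E` as well, so it applies to the maximum.
    y^d≤ : y ^ d ≤ β ^ d * m ^ (d + f)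
    y^d≤ = ℕ.*-cancelˡ-≤ (m ^ d) {{ℕ.m^n≢0 m d}} (begin
      m ^ d * y ^ d                   ≡⟨ ^-distrib-* m y d ⟨
      (m * y) ^ d                     ≤⟨ ℕ.^-monoˡ-≤ d my≤ ⟩
      (2 * (m ℕ.⊔ E)) ^ d             ≡⟨ ^-distrib-* 2 (m ℕ.⊔ E) d ⟩
      2 ^ d * (m ℕ.⊔ E) ^ d           ≤⟨ ℕ.*-monoʳ-≤ (2 ^ d) max^d≤ ⟩
      2 ^ d * (b ^ d * m ^ (2 * d + f)) ≡⟨ cong (λ z → 2 ^ d * (b ^ d * z)) (trans (cong (m ^_) (lemma₁ d f)) (ℕ.^-distribˡ-+-* m d (d + f))) ⟩
      2 ^ d * (b ^ d * (m ^ d * m ^ (d + f))) ≡⟨ lemma₂ (2 ^ d) (b ^ d) (m ^ d) (m ^ (d + f)) ⟩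
      m ^ d * (2 ^ d * b ^ d * m ^ (d + f)) ≡⟨ cong (λ z → m ^ d * (z * m ^ (d + f))) (^-distrib-* 2 b d) ⟨
      m ^ d * (β ^ d * m ^ (d + f))   ∎)
      where
      lemma₁ : ∀ d f → 2 * d + f ≡ d + (d + f)
      lemma₁ = solve-∀
      lemma₂ : ∀ a b c e → a * (b * (c * e)) ≡ c * (a * b * e)
      lemma₂ = solve-∀
      my≤ : m * y ≤ 2 * (m ℕ.⊔ E)
      my≤ = begin
        m * suc (E ℕ./ m)         ≡⟨ ℕ.*-comm m (suc (E ℕ./ m)) ⟩
        m + E ℕ./ m * m           ≤⟨ ℕ.+-mono-≤ (ℕ.m≤m⊔n m E) (ℕ.≤-trans (ℕ.m/n*n≤m E m) (ℕ.m≤n⊔m m E)) ⟩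
        (m ℕ.⊔ E) + (m ℕ.⊔ E)     ≡⟨ cong ((m ℕ.⊔ E) ℕ.+_) (ℕ.+-identityʳ (m ℕ.⊔ E)) ⟨
        2 * (m ℕ.⊔ E)             ∎
      max^d≤ : (m ℕ.⊔ E) ^ d ≤ b ^ d * m ^ (2 * d + f)
      max^d≤ with ℕ.⊔-sel m E
      ... | inj₂ eq rewrite eq = E^d≤
      ... | inj₁ eq rewrite eq = begin
        m ^ d                     ≤⟨ ℕ.^-monoʳ-≤ m (ℕ.≤-trans (ℕ.m≤m+n d (d + 0)) (ℕ.m≤m+n (2 * d) f)) ⟩
        m ^ (2 * d + f)           ≤⟨ ℕ.m≤n*m (m ^ (2 * d + f)) (b ^ d) {{ℕ.m^n≢0 b d}} ⟩
        b ^ d * m ^ (2 * d + f)   ∎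

    open Absorption m y M₀≤m y^d≤

    1≤s : 1 ≤ s
    1≤s = ℕ.m≥n⇒m/n>0 k≤m

    k′s≤c : k′ * s ≤ c
    k′s≤c = ℕ.≤-pred (begin
      suc (k′ * s)     ≤⟨ ℕ.+-monoˡ-≤ (k′ * s) 1≤s ⟩
      s + k′ * s       ≡⟨ ℕ.*-comm s k ⟨
      s * k            ≤⟨ ℕ.m/n*n≤m m k ⟩
      m                ≡⟨ m≡1+c ⟩
      suc c            ∎)

    m≤2ks : m ≤ 2 * k * s
    m≤2ks = begin
      m               ≤⟨ ℕ.<⇒≤ (m<[1+m/n]*n m k) ⟩
      (1 + s) * k     ≤⟨ ℕ.*-monoˡ-≤ k (ℕ.+-monoˡ-≤ s 1≤s) ⟩
      (s + s) * k     ≡⟨ lemma s k ⟩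
      2 * k * s       ∎
      where
      lemma : ∀ s k → (s + s) * k ≡ 2 * k * s
      lemma = solve-∀

    m²≤4k²s² : m * m ≤ 4 * (k * k) * (s * s)
    m²≤4k²s² = ℕ.≤-trans (ℕ.*-mono-≤ m≤2ks m≤2ks) (ℕ.≤-reflexive (lemma k s))
      where
      lemma : ∀ k s → 2 * k * s * (2 * k * s) ≡ 4 * (k * k) * (s * s)
      lemma = solve-∀

    q : ℕ
    q = s * s ℕ./ (24 * y)

    24y≤s² : 24 * y ≤ s * s
    24y≤s² = ℕ.*-cancelˡ-≤ (4 * (k * k)) (begin
      4 * (k * k) * (24 * y)        ≡⟨ lemma₁ k y ⟩
      96 * (k * k) * y              ≤⟨ ℕ.*-monoˡ-≤ y (ℕ.*-monoˡ-≤ (k * k) (ℕ.m≤m+n 96 96)) ⟩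
      K * y                         ≤⟨ Ky≤m² ⟩
      m * m                         ≤⟨ m²≤4k²s² ⟩
      4 * (k * k) * (s * s)         ∎)
      where
      lemma₁ : ∀ k y → 4 * (k * k) * (24 * y) ≡ 96 * (k * k) * y
      lemma₁ = solve-∀

    1≤q : 1 ≤ q
    1≤q = ℕ.m≥n⇒m/n>0 24y≤s²

    w : ℕ
    w = pred q

    q≡1+w : q ≡ suc w
    q≡1+w = sym (ℕ.suc-pred q {{>-nonZero 1≤q}})

    24qy≤s² : 24 * suc w * y ≤ s * s
    24qy≤s² = begin
      24 * suc w * y       ≡⟨ cong (λ z → 24 * z * y) q≡1+w ⟨
      24 * q * y           ≡⟨ lemma q y ⟩
      q * (24 * y)         ≤⟨ ℕ.m/n*n≤m (s * s) (24 * y) ⟩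
      s * s                ∎
      where
      lemma : ∀ q y → 24 * q * y ≡ q * (24 * y)
      lemma = solve-∀

    -- Each rounding loses a factor 2: m ≤ 2ks gives 4k² after squaring, and s² ≤ (1+q) * 24y ≤
    -- 48qy. The product is K = 192k².
    m²≤Kyq : m * m ≤ K * y * q
    m²≤Kyq = begin
      m * m                                    ≤⟨ m²≤4k²s² ⟩
      4 * (k * k) * (s * s)                    ≤⟨ ℕ.*-monoʳ-≤ (4 * (k * k)) (ℕ.<⇒≤ (m<[1+m/n]*n (s * s) (24 * y))) ⟩
      4 * (k * k) * ((1 + q) * (24 * y))       ≤⟨ ℕ.*-monoʳ-≤ (4 * (k * k)) (ℕ.*-monoˡ-≤ (24 * y) (ℕ.+-monoˡ-≤ q 1≤q)) ⟩
      4 * (k * k) * ((q + q) * (24 * y))       ≡⟨ lemma k q y ⟩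
      K * y * q                                ∎
      where
      lemma : ∀ k q y → 4 * (k * k) * ((q + q) * (24 * y)) ≡ 192 * (k * k) * y * q
      lemma = solve-∀

    choice : Choice k′ r m E
    choice = record
      { c           = c
      ; s           = s
      ; w           = w
      ; y           = y
      ; m≡1+c       = m≡1+c
      ; c-nonZero   = >-nonZero 1≤c
      ; 1≤y         = s≤s z≤n
      ; k′s≤c       = k′s≤c
      ; 2E≤4cy      = 2E≤4cy
      ; 24[1+w]y≤s² = 24qy≤s²
      ; few-walks   = subst (λ z → ∀ l → 3 + l < r → 2 * r * (2 * r) * (2 * E) ^ (3 + l) ≤ y * z ^ (3 + l) * (y * z ^ (3 + l)))
                        q≡1+w (few E q E≤my m²≤Kyq)
      }

-- Rational and real exponents

ℕᵘ : ℕ → ℚᵘ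
ℕᵘ n = mkℚᵘ (+ n) 0

toℚᵘ-ℕ⇒ℚ : ∀ n → toℚᵘ (ℕ⇒ℚ n) ≃ ℕᵘ n
toℚᵘ-ℕ⇒ℚ n = ℚ.toℚᵘ-fromℚᵘ (ℕᵘ n)

ℕ⇒ℚ-* : ∀ m n → ℕ⇒ℚ (m * n) ≡ ℕ⇒ℚ m ℚ.* ℕ⇒ℚ n
ℕ⇒ℚ-* m n = ℚ.toℚᵘ-injective (begin-equality
  toℚᵘ (ℕ⇒ℚ (m * n))                 ≃⟨ toℚᵘ-ℕ⇒ℚ (m * n) ⟩
  mkℚᵘ (+ (m * n)) 0                 ≡⟨ cong (λ z → mkℚᵘ z 0) (ℤ.pos-* m n) ⟩
  ℕᵘ m ℚᵘ.* ℕᵘ n                     ≃⟨ ℚᵘ.*-cong (toℚᵘ-ℕ⇒ℚ m) (toℚᵘ-ℕ⇒ℚ n) ⟨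
  toℚᵘ (ℕ⇒ℚ m) ℚᵘ.* toℚᵘ (ℕ⇒ℚ n)     ≃⟨ ℚ.toℚᵘ-homo-* (ℕ⇒ℚ m) (ℕ⇒ℚ n) ⟨
  toℚᵘ (ℕ⇒ℚ m ℚ.* ℕ⇒ℚ n)             ∎)
  where open ℚᵘ.≤-Reasoning

ℕ⇒ℚ-^ : ∀ m n → ℕ⇒ℚ (m ^ n) ≡ ℕ⇒ℚ m ^ℚ n
ℕ⇒ℚ-^ m zero    = refl
ℕ⇒ℚ-^ m (suc n) = trans (ℕ⇒ℚ-* m (m ^ n)) (cong (ℕ⇒ℚ m ℚ.*_) (ℕ⇒ℚ-^ m n))

ℕ⇒ℚ-cancel-≤ : ∀ {m n} → ℕ⇒ℚ m ℚ.≤ ℕ⇒ℚ n → m ≤ n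
ℕ⇒ℚ-cancel-≤ {m} {n} m≤n = ℤ.drop‿+≤+ (subst₂ ℤ._≤_ (ℤ.*-identityʳ (+ m)) (ℤ.*-identityʳ (+ n)) (ℚᵘ.drop-*≤* (begin
  ℕᵘ m             ≃⟨ toℚᵘ-ℕ⇒ℚ m ⟨
  toℚᵘ (ℕ⇒ℚ m)     ≤⟨ ℚ.toℚᵘ-mono-≤ m≤n ⟩
  toℚᵘ (ℕ⇒ℚ n)     ≃⟨ toℚᵘ-ℕ⇒ℚ n ⟩
  ℕᵘ n             ∎)))
  where open ℚᵘ.≤-Reasoning

archimedean : ∀ p → ∃[ b ] p ℚ.< ℕ⇒ℚ (suc b)
archimedean p@(mkℚ i d _) = ℤ.∣ i ∣ , ℚ.toℚᵘ-cancel-< (begin-strict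
  toℚᵘ p                       <⟨ *<* (subst (ℤ._< + suc ℤ.∣ i ∣ ℤ.* + suc d) (sym (ℤ.*-identityʳ i)) (i<∣i∣ i)) ⟩
  ℕᵘ (suc ℤ.∣ i ∣)             ≃⟨ toℚᵘ-ℕ⇒ℚ (suc ℤ.∣ i ∣) ⟨
  toℚᵘ (ℕ⇒ℚ (suc ℤ.∣ i ∣))     ∎)
  where
  open ℚᵘ.≤-Reasoning
  i<∣i∣ : ∀ i → i ℤ.< + suc ℤ.∣ i ∣ ℤ.* + suc d
  i<∣i∣ (+ n)    = subst (+ n ℤ.<_) (ℤ.pos-* (suc n) (suc d)) (ℤ.+<+ (ℕ.m≤m*n (suc n) (suc d)))
  i<∣i∣ -[1+ n ] = ℤ.-<+

≤ᵠ⇒^≤ : ∀ {n b m s a} → ↥ s ≡ + a → n ≤ᵠ ℕ⇒ℚ b · m ^ s → n ^ (↧ₙ s) ≤ b ^ (↧ₙ s) * m ^ a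
≤ᵠ⇒^≤ {n} {b} {m} {s@(mkℚ (+ a) d _)} refl h = ℕ⇒ℚ-cancel-≤
  (subst₂ ℚ._≤_ (sym (ℕ⇒ℚ-^ n (suc d)))
    (sym (trans (ℕ⇒ℚ-* (b ^ suc d) (m ^ a)) (cong₂ ℚ._*_ (ℕ⇒ℚ-^ b (suc d)) (ℕ⇒ℚ-^ m a)))) h)

-- The hypotheses are 2 ≤ i/D and i/D < 2 + 2/N after cross-multiplication; the factors 1 are the
-- denominators left by unfolding the rational sum.
numerator-bounds : ∀ N D i → + 2 ℤ.* + D ℤ.≤ i →
  i ℤ.* + (1 * N) ℤ.< (+ 2 ℤ.* + N ℤ.+ + 2 ℤ.* + 1) ℤ.* + D → ∃[ f ] i ≡ + (2 * D + f) × f * N < 2 * D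
numerator-bounds N D -[1+ i ] lo hi with subst (ℤ._≤ -[1+ i ]) (sym (ℤ.pos-* 2 D)) lo
... | ()
numerator-bounds N D (+ a)    lo hi = a ∸ 2 * D , cong +_ (sym a≡) , ℕ.+-cancelˡ-< (2 * D * N) _ _ (begin-strict
  2 * D * N + (a ∸ 2 * D) * N    ≡⟨ ℕ.*-distribʳ-+ N (2 * D) _ ⟨
  (2 * D + (a ∸ 2 * D)) * N      ≡⟨ cong₂ _*_ a≡ (sym (ℕ.*-identityˡ N)) ⟩
  a * (1 * N)                    <⟨ hi′ ⟩
  (2 * N + 2 * 1) * D            ≡⟨ lemma N D ⟩
  2 * D * N + 2 * D              ∎)
  where
  open ℕ.≤-Reasoning
  a≡ : 2 * D + (a ∸ 2 * D) ≡ a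
  a≡ = ℕ.m+[n∸m]≡n (ℤ.drop‿+≤+ (subst (ℤ._≤ + a) (sym (ℤ.pos-* 2 D)) lo))
  hi′ : a * (1 * N) < (2 * N + 2 * 1) * D
  hi′ = ℤ.drop‿+<+ (subst₂ ℤ._<_ (sym (ℤ.pos-* a (1 * N)))
    (sym (trans (ℤ.pos-* (2 * N + 2 * 1) D) (cong (ℤ._* + D) (trans (ℤ.pos-+ (2 * N) (2 * 1)) (cong (ℤ._+ + 2) (ℤ.pos-* 2 N)))))) hi)
  lemma : ∀ N D → (2 * N + 2 * 1) * D ≡ 2 * D * N + 2 * D
  lemma = solve-∀

numerator : ∀ N .{{_ : NonZero N}} (s : ℚ) → + 2 / 1 ℚ.≤ s → s ℚ.< + 2 / 1 ℚ.+ + 2 / N →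
            ∃[ f ] ↥ s ≡ + (2 * ↧ₙ s + f) × f * N < 2 * ↧ₙ s
numerator N@(suc N-1) s@(mkℚ i d _) 2≤s s< = numerator-bounds N (suc d) i
  (ℤ.≤-trans (ℚᵘ.drop-*≤* (ℚ.toℚᵘ-mono-≤ 2≤s)) (ℤ.≤-reflexive (ℤ.*-identityʳ i)))
  (ℚᵘ.drop-*<* (begin-strict
    mkℚᵘ i d                                  <⟨ ℚ.toℚᵘ-mono-< s< ⟩
    toℚᵘ (+ 2 / 1 ℚ.+ + 2 / N)                ≃⟨ ℚ.toℚᵘ-homo-+ (+ 2 / 1) (+ 2 / N) ⟩
    toℚᵘ (+ 2 / 1) ℚᵘ.+ toℚᵘ (+ 2 / N)        ≃⟨ ℚᵘ.+-cong (ℚ.toℚᵘ-fromℚᵘ (mkℚᵘ (+ 2) 0)) (ℚ.toℚᵘ-fromℚᵘ (mkℚᵘ (+ 2) N-1)) ⟩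
    mkℚᵘ (+ 2) 0 ℚᵘ.+ mkℚᵘ (+ 2) N-1          ∎))
  where open ℚᵘ.≤-Reasoning

-- The upper cut of ε is open, which leaves room for a rational strictly between ε and 2/N. From
-- there on, all exponents are rational.
exponent : ∀ (ε : ℝ) N .{{_ : NonZero N}} → ε <ᵁ + 2 / N →
           ∃[ s ] ((+ 2 / 1) +ʳ ε) <ᵁ s × ∃[ f ] ↥ s ≡ + (2 * ↧ₙ s + f) × f * N < 2 * ↧ₙ s
exponent ε N ε<θ with ℝ.U-open ε ε<θ
... | ε₁ , ε₁<θ , ε<ε₁ = from nonneg
  where
  nonneg : ∃[ ε′ ] 0ℚ ℚ.≤ ε′ × ε′ ℚ.< + 2 / N × ε <ᵁ ε′
  nonneg with ε₁ ℚ.<? 0ℚ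
  -- A negative bound is raised to 0, so that the exponent is at least 2 and `f` is a natural
  -- number.
  ... | yes ε₁<0 = 0ℚ , ℚ.≤-refl , ℚ.positive⁻¹ (+ 2 / N) {{ℚ.normalize-pos 2 N}} , ℝ.U-upper ε ε₁<0 ε<ε₁
  ... | no ε₁≮0  = ε₁ , ℚ.≮⇒≥ ε₁≮0 , ε₁<θ , ε<ε₁
  2+-2 : ∀ p → (+ 2 / 1 ℚ.+ p) ℚ.- + 2 / 1 ≡ p
  2+-2 p = trans (cong (ℚ._- + 2 / 1) (ℚ.+-comm (+ 2 / 1) p))
    (trans (ℚ.+-assoc p (+ 2 / 1) (ℚ.- (+ 2 / 1))) (trans (cong (p ℚ.+_) (ℚ.+-inverseʳ (+ 2 / 1))) (ℚ.+-identityʳ p)))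
  from : ∃[ ε′ ] 0ℚ ℚ.≤ ε′ × ε′ ℚ.< + 2 / N × ε <ᵁ ε′ →
         ∃[ s ] ((+ 2 / 1) +ʳ ε) <ᵁ s × ∃[ f ] ↥ s ≡ + (2 * ↧ₙ s + f) × f * N < 2 * ↧ₙ s
  from (ε′ , 0≤ε′ , ε′<θ , ε<ε′) = + 2 / 1 ℚ.+ ε′ , subst (ε <ᵁ_) (sym (2+-2 ε′)) ε<ε′ ,
    numerator N (+ 2 / 1 ℚ.+ ε′)
      (subst (ℚ._≤ + 2 / 1 ℚ.+ ε′) (ℚ.+-identityʳ (+ 2 / 1)) (ℚ.+-monoʳ-≤ (+ 2 / 1) 0≤ε′))
      (ℚ.+-monoʳ-< (+ 2 / 1) ε′<θ)

-- From the integer parameters to real B and ε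

sparse-subgraph-of-J : ∀ r k′ b d f .{{_ : NonZero d}} .{{_ : NonZero b}} → 4 ≤ r → f * (3 * r ∸ 5) < 2 * d →
  ∃[ M ] (∀ {n} (J : Graph n) m → χ[ J ]≡ m → M ≤ m → length (Colourings.edges J) ^ d ≤ b ^ d * m ^ (2 * d + f) →
    ∃[ H ] H ⊑ J × (∀ l → Cycle H l → r ≤ l) × (∀ j → Colouring H j → k′ < j))
sparse-subgraph-of-J r k′ b d f 4≤r fN<2d = M , λ J m (_ , minimal) M≤m E^d≤ →
  let open Choice (choice m (length (Colourings.edges J)) M≤m E^d≤)
  in sparse-subgraph J c k′ r s w y
       (λ col → ℕ.<⇒≱ (ℕ.≤-reflexive (sym m≡1+c)) (minimal c (toColouring {G = J} col)))
       {{c-nonZero}} k′s≤c (ℕ.≤-trans (ℕ.n≤1+n 3) 4≤r) 1≤y 2E≤4cy 24[1+w]y≤s² few-walks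
  where open Parameters k′ r b d f 4≤r fN<2d using (M; choice)

SparseSubgraph : ∀ {n} → ℕ → ℕ → Graph n → Set₁
SparseSubgraph r k G = ∃[ H ] (H ⊑ G × (∃[ g ] (girth[ H ]≡ g × [ r ] ≤⁺ g)) × (∃[ c ] (χ[ H ]≡ c × k ≤ c)))

sparse-subgraph-of-G : ∀ r k′ b s f → 4 ≤ r → ↥ s ≡ + (2 * ↧ₙ s + f) → f * (3 * r ∸ 5) < 2 * ↧ₙ s →
  ∃[ M ] (∀ {n} (G J : Graph n) m → J ⊑ G → χ[ J ]≡ m → M ≤ m → e J ≤ᵠ ℕ⇒ℚ (suc b) · m ^ s →
    SparseSubgraph r (suc k′) G)
sparse-subgraph-of-G r k′ b s f 4≤r ↥s≡ fN<2d =
  let M , core′ = sparse-subgraph-of-J r k′ (suc b) (↧ₙ s) f 4≤r fN<2d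
  in M , λ G J m (VJ⊆VG , J⊆G) χJ M≤m eJ≤ →
    let H , (VH⊆VJ , H⊆J) , girth≥ , χ> = core′ J m χJ M≤m (≤ᵠ⇒^≤ {e J} {suc b} {m} {s} ↥s≡ eJ≤)
        c , χH = χ-exists H
    in H , ((λ v∈ → VJ⊆VG (VH⊆VJ v∈)) , (λ uv → J⊆G (H⊆J uv))) , ≤-girth girth≥ , c , χH , χ> c (proj₁ χH)

theorem1p6 : (r k : ℕ) (4≤r : 4 ≤ r) → 2 ≤ k →
    (B ε : ℝ) → 0ℚ <ᴸ B → ε <ᵁ _/_ (+ 2) (3 * r ∸ 5) {{3r∸5-nonZero 4≤r}} →
    ∃[ M ] (∀ {n} (G J : Graph n) (m : ℕ) →
    J ⊑ G → χ[ J ]≡ m → M ≤ m → e J ≤ʳ B · m ^ ((+ 2 / 1) +ʳ ε) →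
    ∃[ H ] (H ⊑ G
    × (∃[ g ] (girth[ H ]≡ g × [ r ] ≤⁺ g))
    × (∃[ c ] (χ[ H ]≡ c × k ≤ c))))
theorem1p6 r (suc k′) 4≤r 2≤k B ε _ ε<θ =
  -- The real bound is an infimum over all rational pairs above (B, 2+ε). A single pair suffices: a
  -- positive integer above `B` and the exponent `s`, both independent of the graphs, so that `M` is
  -- too.
  let b₀ , B<b₀                     = ℝ.U-inhabited B
      b , b₀<b                      = archimedean b₀
      s , 2+ε<s , f , ↥s≡ , fN<2d   = exponent ε (3 * r ∸ 5) {{3r∸5-nonZero 4≤r}} ε<θ
      M , sparse                    = sparse-subgraph-of-G r k′ b s f 4≤r ↥s≡ fN<2d
  in M , λ G J m J⊑G χJ M≤m eJ≤ →
       sparse G J m J⊑G χJ M≤m (eJ≤ (ℕ⇒ℚ (suc b)) s (ℝ.U-upper B b₀<b B<b₀) 2+ε<s)
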